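{- Let $n,a\ge 1$ and fix integers $r_1,\dots,r_a\ge 0$ with $\sum_{i=1}^a r_i=n$. The Gessel–Reutenauer map $U$ defines by restriction a cycle-structure preserving bijection $\bar U$ from the set of elements of $S_n$ with descent set contained in $\{r_1,\,r_1+r_2,\dots,r_1+\cdots+r_a=n\}$ onto the set of multisets of primitive necklaces on the alphabet $\{1,\dots,a\}$ formed from a total of $r_i$ letters $i$ for each $i$. Precisely: for each such permutation $\pi$ there is a unique word $w$ of length $n$ containing exactly $r_i$ letters $i$ for each $i$ with $st(w)=\pi^{ -1}$; one sets $\bar U(\pi)=U(w)$; and $\bar U$ is a bijection such that, for every $j\ge1$, the number of $j$-cycles of $\pi$ equals the number (with multiplicity) of necklaces of length $j$ in $\bar U(\pi)$.
   Context: Descents: $\pi\in S_n$ has a descent at position $i$ ($1\le i\le n-1$) if $\pi(i)>\pi(i+1)$; by convention every $\pi\in S_n$ also has a descent at position $n$. The descent set of $\pi$ is the set of positions at which it has a descent. A necklace is a finite nonempty sequence of letters arranged cyclically (a word up to cyclic rotation); its length is its number of letters. It is primitive if it is not equal to any of its non-trivial cyclic shifts (e.g. $(a\,a\,b\,b)$ is primitive, $(a\,b\,a\,b)$ is not). For a word $w=w_1\cdots w_n$ on an ordered alphabet, the standard permutation $st(w)\in S_n$ is the permutation ranking the letters of $w$, ties being broken by regarding the letter further to the left as smaller: $st(w)(i)=\#\{j: w_j<w_i\}+\#\{j\le i: w_j=w_i\}$. The map $U$: given $w$, take the cycles of $st(w)$ and replace each number $i$ in each cycle by the letter $w_i$,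 obtaining a multiset $U(w)$ of necklaces, one per cycle. Cycles are read in the order $(i,\sigma(i),\sigma^2(i),\dots)$ with $\sigma=st(w)^{ -1}$. -}

module Defs where

open import Data.Empty using (⊥; ⊥-elim)
open import Data.Fin.Base using (Fin; zero; suc; toℕ; fromℕ<; punchOut)
import Data.Fin.Base as Fin
open import Data.Fin.Permutation using (Permutation′; permutation; flip; _⟨$⟩ʳ_)
open import Data.Fin.Properties as Fin
  using (toℕ-fromℕ<; any?; injective⇒≤; punchOut-injective)
open import Data.List.Base
  using (List; []; _∷_; [_]; _++_; length; map; concatMap; filter; takeWhile; iterate; allFin)
open import Data.List.Membership.Propositional using (lose)
open import Data.List.Membership.Propositional.Properties using (∈-allFin)
open import Data.List.NonEmpty.Base as List⁺ using (List⁺; _∷_; toList)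
open import Data.List.Properties
  using (++-assoc; ++-identityʳ; filter-some; length-filter; length-tabulate)
open import Data.List.Relation.Unary.All using (All; all?)
import Data.List.Relation.Binary.Permutation.Setoid as Permutation
open import Data.Nat.Base using (ℕ; zero; suc; pred; _+_; _≤_; _<_; z≤n; s≤s)
import Data.Nat.GeneralisedArithmetic as ℕ
import Data.Nat.Properties as ℕ
open import Data.Product.Base using (Σ; ∃; ∃₂; _×_; _,_; proj₁; proj₂)
open import Data.Sum.Base using (_⊎_)
open import Data.Vec.Base using (Vec; []; _∷_; lookup)
open import Function.Base using (id; _∘_)
open import Function.Definitions using (Injective)
open import Level using (0ℓ)
open import Relation.Binary.Bundles using (Setoid)
import Relation.Binary.Construct.On as On
open import Relation.Binary.Definitions using (tri<; tri≈; tri>)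
open import Relation.Binary.PropositionalEquality
  using (_≡_; _≢_; refl; sym; trans; cong; subst; _→-setoid_)
open import Relation.Nullary using (¬_; yes; no; ¬?; _×-dec_)
open import Relation.Unary using (Pred; Decidable; _⊆_)

private
  variable
    n a : ℕ

-- Positions are the numbers 1, …, n; position p corresponds to the index
-- i : Fin n with suc (toℕ i) ≡ p.

DescentSet : Permutation′ n → Pred ℕ 0ℓ
DescentSet {n} π p =
  p ≡ n ⊎
  (∃₂ λ (i j : Fin n) →
     suc (toℕ i) ≡ p × toℕ j ≡ suc (toℕ i) × (π ⟨$⟩ʳ j) Fin.< (π ⟨$⟩ʳ i))

partialSum : Vec ℕ a → Fin a → ℕ
partialSum (x ∷ r) zero    = x
partialSum (x ∷ r) (suc i) = x + partialSum r i

PartialSums : Vec ℕ a → Pred ℕ 0ℓ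
PartialSums r p = ∃ λ i → partialSum r i ≡ p

PermutationWithDescentsIn : ∀ n → Vec ℕ a → Set
PermutationWithDescentsIn n r =
  Σ (Permutation′ n) λ π → DescentSet π ⊆ PartialSums r

PermutationsWithDescentsIn : ∀ n → Vec ℕ a → Setoid 0ℓ 0ℓ
PermutationsWithDescentsIn n r =
  On.setoid {B = PermutationWithDescentsIn n r} (Fin n →-setoid Fin n)
    (λ π i → proj₁ π ⟨$⟩ʳ i)

-- The cycle (i, π i, π² i, …). A cycle has at most n elements, so the n
-- iterates π i, …, πⁿ i include the first return to i.
cycleFrom : Permutation′ n → Fin n → List⁺ (Fin n)
cycleFrom {n} π i =
  i ∷ takeWhile (λ j → ¬? (j Fin.≟ i)) (iterate (π ⟨$⟩ʳ_) (π ⟨$⟩ʳ i) n)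

-- Each cycle is listed once, starting from its least element.
cycles : Permutation′ n → List (List⁺ (Fin n))
cycles {n} π =
  map (cycleFrom π)
    (filter (λ i → all? (i Fin.≤?_) (toList (cycleFrom π i))) (allFin n))

numberOfLength : {A : Set} → ℕ → List (List⁺ A) → ℕ
numberOfLength j us = length (filter (λ u → List⁺.length u ℕ.≟ j) us)

rotate₁ : {A : Set} → List⁺ A → List⁺ A
rotate₁ (x ∷ [])     = x ∷ []
rotate₁ (x ∷ y ∷ ys) = y ∷ (ys ++ [ x ])

rotate : {A : Set} → ℕ → List⁺ A → List⁺ A
rotate k u = ℕ.iterate rotate₁ u k

infix 4 _∼_

_∼_ : {A : Set} → List⁺ A → List⁺ A → Set
u ∼ v = ∃ λ k → rotate k u ≡ v

Primitive : {A : Set} → List⁺ A → Set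
Primitive u = ∀ k → 0 < k → k < List⁺.length u → rotate k u ≢ u

∼-trans : {A : Set} {u v w : List⁺ A} → u ∼ v → v ∼ w → u ∼ w
∼-trans (zero  , refl) q = q
∼-trans (suc k , refl) q with ∼-trans (k , refl) q
... | m , eq = suc m , eq

rotateList : {A : Set} → List A → List A
rotateList []       = []
rotateList (x ∷ xs) = xs ++ [ x ]

toList-injective : {A : Set} {u v : List⁺ A} → toList u ≡ toList v → u ≡ v
toList-injective {u = _ ∷ _} {v = _ ∷ _} refl = refl

toList-rotate : {A : Set} (k : ℕ) (u : List⁺ A) →
                toList (rotate k u) ≡ ℕ.iterate rotateList (toList u) k
toList-rotate zero    u            = refl
toList-rotate (suc k) (x ∷ [])     = toList-rotate k (x ∷ [])
toList-rotate (suc k) (x ∷ y ∷ ys) = toList-rotate k (y ∷ (ys ++ [ x ]))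

rotateList-++ : {A : Set} (xs ys : List A) →
                ℕ.iterate rotateList (xs ++ ys) (length xs) ≡ ys ++ xs
rotateList-++ []       ys = sym (++-identityʳ ys)
rotateList-++ (x ∷ xs) ys = trans
  (cong (λ zs → ℕ.iterate rotateList zs (length xs)) (++-assoc xs ys [ x ]))
  (trans (rotateList-++ xs (ys ++ [ x ])) (++-assoc ys [ x ] xs))

rotate-length : {A : Set} (u : List⁺ A) → rotate (List⁺.length u) u ≡ u
rotate-length u@(x ∷ xs) = toList-injective (trans
  (toList-rotate (List⁺.length u) u)
  (trans
    (cong (λ zs → ℕ.iterate rotateList zs (List⁺.length u))
      (sym (++-identityʳ (x ∷ xs))))
    (rotateList-++ (x ∷ xs) [])))

∼-sym : {A : Set} {u v : List⁺ A} → u ∼ v → v ∼ u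
∼-sym         (zero  , refl) = zero , refl
∼-sym {u = u} (suc k , refl) =
  ∼-trans (∼-sym {u = rotate₁ u} (k , refl))
          (length (List⁺.tail u) , rotate-length u)

-- A necklace is represented by any word obtained by cutting it open.
Necklace : Set → Setoid 0ℓ 0ℓ
Necklace A = record
  { Carrier       = List⁺ A
  ; _≈_           = _∼_
  ; isEquivalence = record
    { refl = zero , refl ; sym = ∼-sym ; trans = ∼-trans }
  }

-- A multiset is represented by any list of its elements.
NecklaceMultiset : Set → Setoid 0ℓ 0ℓ
NecklaceMultiset A = Permutation.↭-setoid (Necklace A)

letterCount : Fin a → List (Fin a) → ℕ
letterCount c xs = length (filter (Fin._≟ c) xs)

HasContent : Vec ℕ a → List (Fin a) → Set
HasContent r xs = ∀ c → letterCount c xs ≡ lookup r c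

PrimitiveMultisetWithContent : Vec ℕ a → Set
PrimitiveMultisetWithContent {a} r =
  Σ (List (List⁺ (Fin a))) λ us →
    All Primitive us × HasContent r (concatMap toList us)

PrimitiveMultisetsWithContent : Vec ℕ a → Setoid 0ℓ 0ℓ
PrimitiveMultisetsWithContent {a} r =
  On.setoid {B = PrimitiveMultisetWithContent r} (NecklaceMultiset (Fin a)) proj₁

# : {P : Pred (Fin n) 0ℓ} → Decidable P → ℕ
# {n} P? = length (filter P? (allFin n))

less? : (w : Vec (Fin a) n) (i : Fin n) →
        Decidable (λ j → lookup w j Fin.< lookup w i)
less? w i j = lookup w j Fin.<? lookup w i

tied? : (w : Vec (Fin a) n) (i : Fin n) →
        Decidable (λ j → j Fin.≤ i × lookup w j ≡ lookup w i)
tied? w i j = (j Fin.≤? i) ×-dec (lookup w j Fin.≟ lookup w i)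

rank : Vec (Fin a) n → Fin n → ℕ
rank w i = # (less? w i) + # (tied? w i)

module _ {A : Set} {P Q R : Pred A 0ℓ}
         (P? : Decidable P) (Q? : Decidable Q) (R? : Decidable R)
         (P⊆R : P ⊆ R) (Q⊆R : Q ⊆ R) (disj : ∀ {x} → P x → Q x → ⊥) where

  filter-disjoint : ∀ xs → length (filter P? xs) + length (filter Q? xs)
                           ≤ length (filter R? xs)
  filter-disjoint [] = z≤n
  filter-disjoint (x ∷ xs) with P? x | Q? x | R? x
  ... | yes p | yes q | _  = ⊥-elim (disj p q)
  ... | yes p | no  _ | no ¬r = ⊥-elim (¬r (P⊆R p))
  ... | no  _ | yes q | no ¬r = ⊥-elim (¬r (Q⊆R q))
  ... | yes _ | no  _ | yes _ = s≤s (filter-disjoint xs)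
  ... | no  _ | yes _ | yes _ =
    subst (_≤ suc (length (filter R? xs))) (sym (ℕ.+-suc _ _))
      (s≤s (filter-disjoint xs))
  ... | no  _ | no  _ | yes _ = ℕ.m≤n⇒m≤1+n (filter-disjoint xs)
  ... | no  _ | no  _ | no  _ = filter-disjoint xs

#-positive : {P : Pred (Fin n) 0ℓ} (P? : Decidable P) {i : Fin n} → P i → 0 < # P?
#-positive P? {i} p = filter-some P? (lose (∈-allFin i) p)

#-strict : {P Q : Pred (Fin n) 0ℓ} (P? : Decidable P) (Q? : Decidable Q) →
           P ⊆ Q → ∀ {i} → Q i → ¬ P i → # P? < # Q?
#-strict {n} P? Q? P⊆Q {i} q ¬p = ℕ.≤-trans
  (ℕ.+-monoˡ-≤ (# P?) (#-positive (Fin._≟ i) refl))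
  (filter-disjoint (Fin._≟ i) P? Q? (λ { refl → q }) P⊆Q (λ { refl → ¬p }) (allFin n))

module _ (w : Vec (Fin a) n) where

  rank-positive : ∀ i → 0 < rank w i
  rank-positive i = ℕ.≤-trans
    (#-positive (tied? w i) {i} (ℕ.≤-refl , refl)) (ℕ.m≤n+m _ _)

  rank≤n : ∀ i → rank w i ≤ n
  rank≤n i = ℕ.≤-trans
    (filter-disjoint (less? w i) (tied? w i) (λ j → j Fin.≤? j)
      (λ _ → ℕ.≤-refl) (λ _ → ℕ.≤-refl)
      (λ p q → ℕ.<⇒≢ p (cong toℕ (proj₂ q))) (allFin n))
    (ℕ.≤-trans (length-filter (λ j → j Fin.≤? j) (allFin n))
      (ℕ.≤-reflexive (length-tabulate id)))

  rank-letter : ∀ {i j} → lookup w i Fin.< lookup w j → rank w i < rank w j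
  rank-letter {i} {j} wi<wj = ℕ.<-≤-trans
    (s≤s (filter-disjoint (less? w i) (tied? w i) (less? w j)
      (λ p → ℕ.<-trans p wi<wj)
      (λ q → subst (Fin._< lookup w j) (sym (proj₂ q)) wi<wj)
      (λ p q → ℕ.<⇒≢ p (cong toℕ (proj₂ q))) (allFin n)))
    (ℕ.≤-trans (ℕ.≤-reflexive (ℕ.+-comm 1 _))
      (ℕ.+-monoʳ-≤ (# (less? w j)) (#-positive (tied? w j) {j} (ℕ.≤-refl , refl))))

  rank-tie : ∀ {i j} → lookup w i ≡ lookup w j → i Fin.< j → rank w i < rank w j
  rank-tie {i} {j} eq i<j = ℕ.+-mono-≤-<
    (ℕ.≤-trans (ℕ.m≤m+n _ _)
      (filter-disjoint (less? w i) (λ k → k Fin.<? k) (less? w j)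
        (subst (lookup w _ Fin.<_) eq)
        (λ k<k → ⊥-elim (ℕ.<-irrefl refl k<k))
        (λ _ → ℕ.<-irrefl refl) (allFin n)))
    (#-strict (tied? w i) (tied? w j)
      (λ (k≤i , e) → ℕ.≤-trans k≤i (ℕ.<⇒≤ i<j) , trans e eq)
      {j} (ℕ.≤-refl , refl)
      (λ (j≤i , _) → ℕ.<⇒≱ i<j j≤i))

  rank-injective : ∀ {i j} → rank w i ≡ rank w j → i ≡ j
  rank-injective {i} {j} eq with Fin.<-cmp (lookup w i) (lookup w j)
  ... | tri< l _ _ = ⊥-elim (ℕ.<⇒≢ (rank-letter l) eq)
  ... | tri> _ _ g = ⊥-elim (ℕ.<⇒≢ (rank-letter g) (sym eq))
  ... | tri≈ _ e _ with Fin.<-cmp i j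
  ...   | tri< l _ _ = ⊥-elim (ℕ.<⇒≢ (rank-tie e l) eq)
  ...   | tri≈ _ i≡j _ = i≡j
  ...   | tri> _ _ g = ⊥-elim (ℕ.<⇒≢ (rank-tie (sym e) g) (sym eq))

injective⇒surjective : (f : Fin n → Fin n) → Injective _≡_ _≡_ f → ∀ y → ∃ λ x → f x ≡ y
injective⇒surjective {suc n} f inj y with any? (λ x → f x Fin.≟ y)
... | yes p = p
... | no ¬p = ⊥-elim (ℕ.1+n≰n (injective⇒≤ {f = λ x → punchOut (y≢f x)}
    (λ {x} {x′} e → inj (punchOut-injective (y≢f x) (y≢f x′) e))))
  where
  y≢f : ∀ x → y ≢ f x
  y≢f x e = ¬p (x , sym e)

permutationOf : (f : Fin n → Fin n) → Injective _≡_ _≡_ f → Permutation′ n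
permutationOf f inj = permutation f (proj₁ ∘ injective⇒surjective f inj)
  (proj₂ ∘ injective⇒surjective f inj) (λ x → inj (proj₂ (injective⇒surjective f inj (f x))))

pred-rank<n : (w : Vec (Fin a) n) (i : Fin n) → pred (rank w i) < n
pred-rank<n w i with rank w i | rank-positive w i | rank≤n w i
... | suc _ | _ | le = le

-- rank takes values in {1, …, n}, which is shifted to Fin n.
stFun : Vec (Fin a) n → Fin n → Fin n
stFun w i = fromℕ< (pred-rank<n w i)

suc-stFun : (w : Vec (Fin a) n) (i : Fin n) → suc (toℕ (stFun w i)) ≡ rank w i
suc-stFun w i = trans (cong suc (toℕ-fromℕ< (pred-rank<n w i))) (lemma (rank-positive w i))
  where
  lemma : ∀ {m} → 0 < m → suc (pred m) ≡ m
  lemma (s≤s _) = refl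

st : Vec (Fin a) n → Permutation′ n
st w = permutationOf (stFun w) λ {i} {j} e → rank-injective w
  (trans (sym (suc-stFun w i)) (trans (cong (suc ∘ toℕ) e) (suc-stFun w j)))

U : Vec (Fin a) n → List (List⁺ (Fin a))
U w = map (List⁺.map (lookup w)) (cycles (flip (st w)))

{-# OPTIONS --safe #-}

-- Let c be the weakly increasing word of content r. A permutation π has its
-- descents among the partial sums of r iff it is increasing on the blocks of
-- equal letters of c, and then w = c ∘ π⁻¹; up to rotation the necklaces of
-- U w are the cycles of π read through c. Write s(i) for the infinite periodic
-- word c(i) c(π i) c(π² i) …. Then i ≤ j implies s(i) ≤ s(j), and if s(i) = s(j)
-- with i < j then π i < π j with s(π i) = s(π j), and so on forever. Hence
-- distinct elements of a cycle have distinct words, that is, its necklace is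
-- primitive. The necklaces determine the sorted sequence s(1) ≤ … ≤ s(n), so
-- two permutations with the same necklaces differ by a permutation that
-- preserves s and is increasing on its fibres, hence by the identity.
-- Conversely, sorting all the rotations of given primitive necklaces by the
-- infinite words they start (ties broken by a numbering of the necklaces)
-- turns the rotation of all necklaces by one letter into such a permutation.
module Submission where

open import Defs
open import Data.Nat.Base using (ℕ; _≤_)
open import Data.Fin.Base using (Fin)
open import Data.Fin.Permutation using (flip; _≈_)
open import Data.Product using (Σ-syntax; ∃!; _×_; proj₁)
open import Data.Vec.Base using (Vec; sum; toList)
open import Function.Bundles using (Bijection)
open import Relation.Binary.Bundles using (Setoid)
open import Relation.Binary.PropositionalEquality using (_≡_)

open import Data.Empty using (⊥; ⊥-elim)
open import Data.Fin.Base as Fin using (zero; suc; toℕ; fromℕ<)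
open import Data.Fin.Permutation using (Permutation′; _⟨$⟩ʳ_; _⟨$⟩ˡ_; inverseˡ; inverseʳ)
import Data.Fin.Properties as Fin
open import Data.List.Base as List
  using (List; []; _∷_; _++_; [_]; length; map; filter; takeWhile; concatMap; applyUpTo; allFin)
import Data.List.Extrema as Extrema
open import Data.List.Membership.Propositional using (_∈_; find; lose)
open import Data.List.Membership.Propositional.Properties
open import Data.List.Membership.Propositional.Properties.WithK using (unique∧set⇒bag)
open import Data.List.NonEmpty.Base as List⁺ using (List⁺; _∷_)
open import Data.List.Properties
open import Data.List.Relation.Binary.BagAndSetEquality using (∼bag⇒↭)
import Data.List.Relation.Binary.Permutation.Homogeneous as Homogeneous
open import Data.List.Relation.Binary.Permutation.Propositional
  using (_↭_; ↭-refl; ↭-sym; ↭-trans; ↭-reflexive; ↭⇒↭ₛ; prep)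
import Data.List.Relation.Binary.Permutation.Propositional.Properties as ↭
import Data.List.Relation.Binary.Permutation.Setoid.Properties as ↭ₛ
open import Data.List.Relation.Binary.Pointwise as Pointwise using (Pointwise; []; _∷_)
open import Data.List.Relation.Unary.All as All using (All; []; _∷_; all?)
import Data.List.Relation.Unary.All.Properties as All
open import Data.List.Relation.Unary.AllPairs as AllPairs using (AllPairs; []; _∷_)
import Data.List.Relation.Unary.AllPairs.Properties as AllPairs
open import Data.List.Relation.Unary.Any using (here; there)
open import Data.List.Relation.Unary.Sorted.TotalOrder.Properties
  using (AllPairs⇒Sorted; lookup-mono-≤; ↗↭↗⇒≋)
open import Data.List.Relation.Unary.Unique.Propositional using (Unique)
import Data.List.Relation.Unary.Unique.Propositional.Properties as Unique
import Data.List.Sort as Sort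
open import Data.Nat.Base
  using (zero; suc; _+_; _*_; _∸_; _^_; _!; _<_; z≤n; s≤s; z<s; s≤s⁻¹)
open import Data.Nat.Divisibility using (_∣_; divides; m∣m*n; ∣-trans; m≤n⇒m!∣n!; ∣⇒≤)
open import Data.Nat.DivMod using (_%_; _/_; m≡m%n+[m/n]*n; m%n<n)
open import Data.Nat.GeneralisedArithmetic using (iterate)
import Data.Nat.Properties as ℕ
open import Data.Product using (∃; _,_; proj₂)
open import Data.Sum.Base using (inj₁; inj₂)
open import Data.Vec.Base as Vec using ([]; _∷_; lookup)
import Data.Vec.Properties as Vec
open import Function.Base using (_∘_; id)
open import Function.Bundles using (mk⇔)
open import Function.Definitions using (Injective)
open import Level using (0ℓ)
open import Relation.Binary.Bundles using (DecTotalOrder; TotalOrder)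
import Relation.Binary.Construct.On as On
open import Relation.Binary.Core using (Rel)
open import Relation.Binary.Definitions using (tri<; tri≈; tri>)
open import Relation.Binary.PropositionalEquality
  using (_≢_; _≗_; refl; sym; trans; cong; cong₂; subst; subst₂; setoid; module ≡-Reasoning)
open import Relation.Binary.Structures using (IsTotalOrder)
open import Relation.Nullary using (¬_; yes; no; ¬?)
open import Relation.Unary using (Pred; Decidable; _⊆_)
open Homogeneous using (Permutation)

private
  variable
    A B : Set
    n a : ℕ

-- Iterates and least periods.

iterate-+ : ∀ (f : A → A) x m k → iterate f x (m + k) ≡ iterate f (iterate f x m) k
iterate-+ f x zero    k = refl
iterate-+ f x (suc m) k = iterate-+ f (f x) m k

iterate-suc : ∀ (f : A → A) x k → iterate f x (suc k) ≡ f (iterate f x k)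
iterate-suc f x zero    = refl
iterate-suc f x (suc k) = iterate-suc f (f x) k

iterate-commute : ∀ {f : A → A} {g : B → B} (h : A → B) → (∀ x → h (f x) ≡ g (h x)) →
                  ∀ x k → h (iterate f x k) ≡ iterate g (h x) k
iterate-commute         h eq x zero    = refl
iterate-commute {g = g} h eq x (suc k) =
  trans (iterate-commute h eq _ k) (cong (λ y → iterate g y k) (eq x))

iterate-injective : ∀ {f : A → A} → Injective _≡_ _≡_ f →
                    ∀ k {x y} → iterate f x k ≡ iterate f y k → x ≡ y
iterate-injective inj zero    eq = eq
iterate-injective inj (suc k) eq = inj (iterate-injective inj k eq)

iterate-* : ∀ (f : A → A) {x d} → iterate f x d ≡ x → ∀ q → iterate f x (q * d) ≡ x
iterate-* f ret zero = refl
iterate-* f {x} {d} ret (suc q) = trans (iterate-+ f x d (q * d))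
  (trans (cong (λ y → iterate f y (q * d)) ret) (iterate-* f ret q))

iterate-∣ : ∀ (f : A → A) {x d m} → iterate f x d ≡ x → d ∣ m → iterate f x m ≡ x
iterate-∣ f ret (divides q refl) = iterate-* f ret q

iterate-return : ∀ (f : A → A) {x d} → iterate f x d ≡ x → 0 < d →
                 ∀ k → ∃ λ j → iterate f (iterate f x k) j ≡ x
-- `k * e` further steps make `k * suc e` in all, a multiple of the period.
iterate-return f {x} {suc e} ret _ k = k * e ,
  trans (sym (iterate-+ f x k (k * e)))
    (trans (cong (iterate f x) (sym (ℕ.*-suc k e))) (iterate-* f ret k))

listIterate≡applyUpTo : ∀ (f : A → A) x m → List.iterate f x m ≡ applyUpTo (iterate f x) m
listIterate≡applyUpTo f x zero    = refl
listIterate≡applyUpTo f x (suc m) = cong (x ∷_) (listIterate≡applyUpTo f (f x) m)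

map-listIterate : ∀ {C : Set} {f : A → A} {g : B → B} {p : A → C} {q : B → C} (h : A → B) →
                  (∀ x → h (f x) ≡ g (h x)) → (∀ x → p x ≡ q (h x)) →
                  ∀ x m → map p (List.iterate f x m) ≡ map q (List.iterate g (h x) m)
map-listIterate h eq eq′ x zero = refl
map-listIterate {g = g} {q = q} h eq eq′ x (suc m) = cong₂ _∷_ (eq′ x)
  (trans (map-listIterate h eq eq′ _ m) (cong (λ y → map q (List.iterate g y m)) (eq x)))

∈-listIterate⁻ : ∀ (f : A → A) {x y} d → y ∈ List.iterate f x d → ∃ λ k → iterate f x k ≡ y
∈-listIterate⁻ f {x} {y} d y∈
  with k , _ , eq ← ∈-applyUpTo⁻ (iterate f x) {y} {d} (subst (y ∈_) (listIterate≡applyUpTo f x d) y∈)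
  = k , sym eq

∈-listIterate⁺ : ∀ (f : A → A) {x d} → iterate f x d ≡ x → 0 < d →
                 ∀ k → iterate f x k ∈ List.iterate f x d
∈-listIterate⁺ f {x} {d@(suc _)} ret _ k = subst₂ _∈_ reduced (sym (listIterate≡applyUpTo f x d))
  (∈-applyUpTo⁺ (iterate f x) (m%n<n k d))
  where
  reduced : iterate f x (k % d) ≡ iterate f x k
  reduced = begin
    iterate f x (k % d)
      ≡⟨ cong (λ y → iterate f y (k % d)) (iterate-* f ret (k / d)) ⟨
    iterate f (iterate f x (k / d * d)) (k % d)   ≡⟨ iterate-+ f x (k / d * d) (k % d) ⟨
    iterate f x (k / d * d + k % d)
      ≡⟨ cong (iterate f x) (ℕ.+-comm (k / d * d) (k % d)) ⟩
    iterate f x (k % d + k / d * d)               ≡⟨ cong (iterate f x) (m≡m%n+[m/n]*n k d) ⟨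
    iterate f x k                                 ∎
    where open ≡-Reasoning

-- The least positive period. Its uniqueness is what matches lengths of cycles with lengths of
-- primitive necklaces.
record IsPeriod {A : Set} (f : A → A) (x : A) (d : ℕ) : Set where
  field
    positive : 0 < d
    returns  : iterate f x d ≡ x
    first    : ∀ k → 0 < k → k < d → iterate f x k ≢ x

open IsPeriod

isPeriod-unique : ∀ {f : A → A} {x c d} → IsPeriod f x c → IsPeriod f x d → c ≡ d
isPeriod-unique {c = c} {d} p q with ℕ.<-cmp c d
... | tri< c<d _ _ = ⊥-elim (first q c (positive p) c<d (returns p))
... | tri≈ _ eq _  = eq
... | tri> _ _ d<c = ⊥-elim (first p d (positive q) d<c (returns q))

isPeriod-map : ∀ {f : A → A} {g : B → B} (h : A → B) → (∀ x → h (f x) ≡ g (h x)) →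
               Injective _≡_ _≡_ h → ∀ {x d} → IsPeriod f x d → IsPeriod g (h x) d
isPeriod-map h eq inj {x} p .positive = positive p
isPeriod-map h eq inj {x} {d} p .returns = trans (sym (iterate-commute h eq x d)) (cong h (returns p))
isPeriod-map h eq inj {x} p .first k 0<k k<d e =
  first p k 0<k k<d (inj (trans (iterate-commute h eq x k) e))

isPeriod-step : ∀ {f : A → A} → Injective _≡_ _≡_ f → ∀ {x d} → IsPeriod f x d → IsPeriod f (f x) d
isPeriod-step {f = f} inj = isPeriod-map f (λ _ → refl) inj

unique-listIterate : ∀ {f : A → A} {x d} → IsPeriod f x d → Unique (List.iterate f x d)
unique-listIterate {f = f} {x} {d} p = subst Unique (sym (listIterate≡applyUpTo f x d))
  (Unique.applyUpTo⁺₁ (iterate f x) d distinct)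
  where
  distinct : ∀ {i j} → i < j → j < d → iterate f x i ≢ iterate f x j
  -- Following the two equal iterates up to time `d` gives a return to `x` after `i + (d ∸ j)`
  -- steps, fewer than `d`.
  distinct {i} {j} i<j j<d eq = first p (i + (d ∸ j))
    (ℕ.<-≤-trans (ℕ.m<n⇒0<n∸m j<d) (ℕ.m≤n+m (d ∸ j) i))
    (ℕ.<-≤-trans (ℕ.+-monoˡ-< (d ∸ j) i<j) (ℕ.≤-reflexive (ℕ.m+[n∸m]≡n (ℕ.<⇒≤ j<d))))
    (begin
      iterate f x (i + (d ∸ j))             ≡⟨ iterate-+ f x i (d ∸ j) ⟩
      iterate f (iterate f x i) (d ∸ j)     ≡⟨ cong (λ y → iterate f y (d ∸ j)) eq ⟩
      iterate f (iterate f x j) (d ∸ j)     ≡⟨ iterate-+ f x j (d ∸ j) ⟨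
      iterate f x (j + (d ∸ j))             ≡⟨ cong (iterate f x) (ℕ.m+[n∸m]≡n (ℕ.<⇒≤ j<d)) ⟩
      iterate f x d                         ≡⟨ returns p ⟩
      x                                     ∎)
    where open ≡-Reasoning

-- Two of the first `n + 1` iterates coincide by the pigeonhole principle, and injectivity cancels
-- the steps they have in common.
iterate-return-finite : ∀ {f : Fin n → Fin n} → Injective _≡_ _≡_ f →
                        ∀ x → ∃ λ k → k < n × iterate f x (suc k) ≡ x
iterate-return-finite {n} {f} inj x
  with i , j , i<j , eq ← Fin.pigeonhole (ℕ.n<1+n n) (λ i → iterate f x (toℕ i))
  with toℕ j ∸ toℕ i | ℕ.m<n⇒0<n∸m i<j | ℕ.m∸n+n≡m (ℕ.<⇒≤ i<j) | ℕ.m∸n≤m (toℕ j) (toℕ i)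
... | suc k | _ | k+i≡j | k<j = k , ℕ.≤-trans k<j (s≤s⁻¹ (Fin.toℕ<n j)) ,
  iterate-injective inj (toℕ i) (trans (sym (iterate-+ f x (suc k) (toℕ i)))
    (trans (cong (iterate f x) k+i≡j) (sym eq)))

module _ {P : Pred A 0ℓ} (P? : Decidable P) (f : A → A) where

  -- Here `e` is the index at which `takeWhile` stops. The last component deals with truncation: if
  -- some iterate among the first `m` fails `P`, then the stop is due to a failure at `e` and not to
  -- the end of the list.
  takeWhile-listIterate : ∀ x m → let ys = takeWhile P? (List.iterate f x m); e = length ys in
    ys ≡ List.iterate f x e × (∀ k → k < e → P (iterate f x k)) ×
    ((∃ λ k → k < m × ¬ P (iterate f x k)) → ¬ P (iterate f x e))
  takeWhile-listIterate x zero = refl , (λ _ ()) , λ ()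
  takeWhile-listIterate x (suc m) with P? x
  ... | no ¬p = refl , (λ _ ()) , λ _ → ¬p
  ... | yes p with eq , before , after ← takeWhile-listIterate (f x) m
    = cong (x ∷_) eq , before′ , after′
    where
    e = length (takeWhile P? (List.iterate f (f x) m))
    before′ : ∀ k → k < suc e → P (iterate f x k)
    before′ zero    _         = p
    before′ (suc k) (s≤s k<e) = before k k<e
    after′ : (∃ λ k → k < suc m × ¬ P (iterate f x k)) → ¬ P (iterate f x (suc e))
    after′ (zero  , _       , ¬p) = ⊥-elim (¬p p)
    after′ (suc k , s≤s k<m , ¬p) = after (k , k<m , ¬p)

-- Cycles of a permutation.

permutation-injective : (π : Permutation′ n) → Injective _≡_ _≡_ (π ⟨$⟩ʳ_)
permutation-injective π eq =
  trans (sym (inverseˡ π)) (trans (cong (π ⟨$⟩ˡ_) eq) (inverseˡ π))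

module _ (π : Permutation′ n) (i : Fin n) where

  private
    f = π ⟨$⟩ʳ_
    ≢i? : Decidable (_≢ i)
    ≢i? j = ¬? (j Fin.≟ i)

  -- A return to `i` occurs within `n` steps, so the `takeWhile` in `cycleFrom` is stopped by that
  -- return and not by the end of the list of iterates.
  cycleFrom-period : IsPeriod f i (List⁺.length (cycleFrom π i))
  cycleFrom-period .positive = z<s
  cycleFrom-period .returns with proj₂ (proj₂ (takeWhile-listIterate ≢i? f (f i) n))
                                | iterate-return-finite (permutation-injective π) i
  ... | after | k , k<n , eq with iterate f (f i) (length (takeWhile ≢i? (List.iterate f (f i) n))) Fin.≟ i
  ...   | yes p = p
  ...   | no ¬p = ⊥-elim (after (k , k<n , λ ≢i → ≢i eq) ¬p)
  cycleFrom-period .first (suc k) _ (s≤s k<e) =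
    proj₁ (proj₂ (takeWhile-listIterate ≢i? f (f i) n)) k k<e

  toList-cycleFrom : List⁺.toList (cycleFrom π i) ≡ List.iterate f i (List⁺.length (cycleFrom π i))
  toList-cycleFrom = cong (i ∷_) (proj₁ (takeWhile-listIterate ≢i? f (f i) n))

-- Each point returns after at most `n` steps, and any such number divides `n !`. This gives a
-- common period for all points and all permutations.
iterate-! : ∀ {f : Fin n → Fin n} → Injective _≡_ _≡_ f → ∀ x → iterate f x (n !) ≡ x
iterate-! {n} {f} inj x with k , k<n , eq ← iterate-return-finite inj x =
  iterate-∣ f {d = suc k} eq (∣-trans (m∣m*n (k !)) (m≤n⇒m!∣n! k<n))

listIterate-∷ʳ : ∀ (f : A → A) x e →
                 List.iterate f x e ++ [ iterate f x e ] ≡ List.iterate f x (suc e)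
listIterate-∷ʳ f x zero    = refl
listIterate-∷ʳ f x (suc e) = cong (x ∷_) (listIterate-∷ʳ f (f x) e)

-- For lists without repetitions, equality as sets is already equality as bags.
unique-⊆⊇⇒↭ : ∀ {xs ys : List A} → Unique xs → Unique ys →
              (∀ {x} → x ∈ xs → x ∈ ys) → (∀ {x} → x ∈ ys → x ∈ xs) → xs ↭ ys
unique-⊆⊇⇒↭ uxs uys to from = ∼bag⇒↭ (unique∧set⇒bag uxs uys (mk⇔ to from))

map-permutation-allFin : (π : Permutation′ n) → map (π ⟨$⟩ʳ_) (allFin n) ↭ allFin n
map-permutation-allFin {n} π = unique-⊆⊇⇒↭
  (Unique.map⁺ (permutation-injective π) (Unique.allFin⁺ n)) (Unique.allFin⁺ n)
  (λ {x} _ → ∈-allFin x)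
  (λ {x} _ → subst (_∈ map (π ⟨$⟩ʳ_) (allFin n)) (inverseʳ π) (∈-map⁺ (π ⟨$⟩ʳ_) (∈-allFin _)))

module _ (π : Permutation′ n) where

  private
    f = π ⟨$⟩ʳ_

  -- The `i` moved to the end is the next iterate because the cycle closes there; the lengths agree
  -- because `i` and `f i` have the same least period.
  rotate₁-cycleFrom : ∀ i → rotate₁ (cycleFrom π i) ≡ cycleFrom π (f i)
  rotate₁-cycleFrom i = toList-injective (begin
    List⁺.toList (rotate₁ (cycleFrom π i))         ≡⟨ toList-rotate 1 (cycleFrom π i) ⟩
    rotateList (List⁺.toList (cycleFrom π i))      ≡⟨ cong rotateList (toList-cycleFrom π i) ⟩
    List.iterate f (f i) e ++ [ i ]
      ≡⟨ cong (λ j → List.iterate f (f i) e ++ [ j ]) (returns p) ⟨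
    List.iterate f (f i) e ++ [ iterate f (f i) e ] ≡⟨ listIterate-∷ʳ f (f i) e ⟩
    List.iterate f (f i) (suc e)             ≡⟨ cong (List.iterate f (f i)) (isPeriod-unique
                                                  (isPeriod-step (permutation-injective π) p)
                                                  (cycleFrom-period π (f i))) ⟩
    List.iterate f (f i) (List⁺.length (cycleFrom π (f i))) ≡⟨ toList-cycleFrom π (f i) ⟨
    List⁺.toList (cycleFrom π (f i))               ∎)
    where
    open ≡-Reasoning
    e = length (List⁺.tail (cycleFrom π i))
    p = cycleFrom-period π i

  ∈-cycleFrom⁺ : ∀ i k → iterate f i k ∈ List⁺.toList (cycleFrom π i)
  ∈-cycleFrom⁺ i k = subst (iterate f i k ∈_) (sym (toList-cycleFrom π i))
    (∈-listIterate⁺ f (returns p) (positive p) k)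
    where p = cycleFrom-period π i

  ∈-cycleFrom⁻ : ∀ {i j} → j ∈ List⁺.toList (cycleFrom π i) → ∃ λ k → iterate f i k ≡ j
  ∈-cycleFrom⁻ {i} {j} j∈ = ∈-listIterate⁻ f _ (subst (j ∈_) (toList-cycleFrom π i) j∈)

  ∈-cycleFrom-sym : ∀ {i j} → j ∈ List⁺.toList (cycleFrom π i) → i ∈ List⁺.toList (cycleFrom π j)
  ∈-cycleFrom-sym {i} j∈ with k , refl ← ∈-cycleFrom⁻ j∈
    with m , eq ← iterate-return f {d = List⁺.length (cycleFrom π i)}
           (returns (cycleFrom-period π i)) z<s k =
    subst (_∈ _) eq (∈-cycleFrom⁺ _ m)

  ∈-cycleFrom-trans : ∀ {i j k} → j ∈ List⁺.toList (cycleFrom π i) → k ∈ List⁺.toList (cycleFrom π j) →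
                      k ∈ List⁺.toList (cycleFrom π i)
  ∈-cycleFrom-trans {i} j∈ k∈ with p , refl ← ∈-cycleFrom⁻ j∈ | q , refl ← ∈-cycleFrom⁻ k∈ =
    subst (_∈ _) (iterate-+ f i p q) (∈-cycleFrom⁺ i (p + q))

  IsLeast : Pred (Fin n) 0ℓ
  IsLeast i = All (i Fin.≤_) (List⁺.toList (cycleFrom π i))

  -- The filter inside `cycles`, named so that `cycles π` unfolds to `map (cycleFrom π) (leasts π)`.
  leasts : List (Fin n)
  leasts = filter (λ i → all? (i Fin.≤?_) (List⁺.toList (cycleFrom π i))) (allFin n)

  leasts-unique : Unique leasts
  leasts-unique = Unique.filter⁺ _ (Unique.allFin⁺ n)

  ∈-leasts⁻ : ∀ {i} → i ∈ leasts → IsLeast i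
  ∈-leasts⁻ i∈ = proj₂ (∈-filter⁻ _ {xs = allFin n} i∈)

  least-in-cycle : ∀ j → ∃ λ i → i ∈ leasts × i ∈ List⁺.toList (cycleFrom π j)
  least-in-cycle j = i , ∈-filter⁺ _ (∈-allFin i) i≤ , i∈
    where
    open Extrema (Fin.≤-totalOrder n)
    xs = List⁺.tail (cycleFrom π j)
    i = argmin id j xs
    i∈ : i ∈ j ∷ xs
    i∈ with argmin-sel id j xs
    ... | inj₁ eq = here eq
    ... | inj₂ i∈xs = there i∈xs
    i≤ : IsLeast i
    i≤ = All.tabulate λ k∈ → All.lookup
      (f[argmin]≤f[⊤] {f = id} j xs ∷ f[argmin]≤f[xs] {f = id} j xs) (∈-cycleFrom-trans i∈ k∈)

  least-unique : ∀ {i j} → i ∈ leasts → j ∈ leasts → j ∈ List⁺.toList (cycleFrom π i) → i ≡ j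
  least-unique i∈ j∈ j∈i = Fin.≤-antisym
    (All.lookup (∈-leasts⁻ i∈) j∈i) (All.lookup (∈-leasts⁻ j∈) (∈-cycleFrom-sym j∈i))

  -- Every point lies in the cycle of some least element, two listed cycles that share a point have
  -- the same least element, and no cycle repeats a point.
  concat-cycles : concatMap List⁺.toList (cycles π) ↭ allFin n
  concat-cycles = unique-⊆⊇⇒↭ unique (Unique.allFin⁺ n) (λ {x} _ → ∈-allFin x) λ {x} _ → complete x
    where
    complete : ∀ j → j ∈ concatMap List⁺.toList (cycles π)
    complete j = let i , i∈ , i∈j = least-in-cycle j in
      ∈-concatMap⁺ List⁺.toList (lose (∈-map⁺ (cycleFrom π) i∈) (∈-cycleFrom-sym i∈j))
    disjoint : ∀ {is} → Unique is → All (_∈ leasts) is →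
               AllPairs (λ i j → ∀ {k} →
                 ¬ (k ∈ List⁺.toList (cycleFrom π i) × k ∈ List⁺.toList (cycleFrom π j))) is
    disjoint [] [] = []
    disjoint (i≢ ∷ u) (i∈ ∷ is⊆) = All.tabulate
      (λ j∈ {k} (k∈i , k∈j) → All.lookup i≢ j∈ (least-unique i∈ (All.lookup is⊆ j∈)
        (∈-cycleFrom-trans k∈i (∈-cycleFrom-sym k∈j)))) ∷ disjoint u is⊆
    unique : Unique (concatMap List⁺.toList (cycles π))
    unique = Unique.concat⁺
      (All.map⁺ (All.map⁺ (All.universal
        (λ i → subst Unique (sym (toList-cycleFrom π i))
          (unique-listIterate (cycleFrom-period π i))) leasts)))
      (AllPairs.map⁺ (AllPairs.map⁺ (disjoint leasts-unique (All.tabulate id))))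

-- Monotone maps and sorted sequences on a finite chain.

module _ {R : Rel (Fin n) 0ℓ} (R⊆< : ∀ {x y} → R x y → x Fin.< y)
         (f : Fin n → Fin n) (mono : ∀ {x y} → R x y → R (f x) (f y)) where

  -- Preservation of `R` propagates the first rise along the whole orbit, and `n` successive rises
  -- leave `Fin n`.
  no-ascent : ∀ {x} → ¬ R x (f x)
  no-ascent {x} r = ℕ.<⇒≱ (Fin.toℕ<n (iterate f x n)) (bound n)
    where
    ascent : ∀ k → R (iterate f x k) (f (iterate f x k))
    ascent zero    = r
    ascent (suc k) = subst (λ y → R y (f y)) (sym (iterate-suc f x k)) (mono (ascent k))
    bound : ∀ k → k ≤ toℕ (iterate f x k)
    bound zero    = z≤n
    bound (suc k) = ℕ.≤-trans (s≤s (bound k))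
      (subst (λ y → iterate f x k Fin.< y) (sym (iterate-suc f x k)) (R⊆< (ascent k)))

  -- Dually the orbit would fall at every step, and `suc (toℕ x)` falls starting from `x` are too
  -- many.
  no-descent : ∀ {x} → ¬ R (f x) x
  no-descent {x} r = ℕ.<⇒≱ (ℕ.n<1+n (toℕ x)) (ℕ.≤-trans (ℕ.m≤n+m _ _) (bound (suc (toℕ x))))
    where
    descent : ∀ k → R (f (iterate f x k)) (iterate f x k)
    descent zero    = r
    descent (suc k) = subst (λ y → R (f y) y) (sym (iterate-suc f x k)) (mono (descent k))
    bound : ∀ k → toℕ (iterate f x k) + k ≤ toℕ x
    bound zero    = ℕ.≤-reflexive (ℕ.+-identityʳ _)
    bound (suc k) = ℕ.≤-trans (ℕ.≤-reflexive (ℕ.+-suc _ k)) (ℕ.≤-trans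
      (ℕ.+-monoˡ-≤ k (subst (λ y → y Fin.< iterate f x k) (sym (iterate-suc f x k)) (R⊆< (descent k))))
      (bound k))

strictlyMonotone⇒id : (f : Fin n → Fin n) → (∀ {i j} → i Fin.< j → f i Fin.< f j) → ∀ i → f i ≡ i
strictlyMonotone⇒id f mono i with Fin.<-cmp (f i) i
... | tri< l _ _ = ⊥-elim (no-descent (λ l → l) f mono l)
... | tri≈ _ e _ = e
... | tri> _ _ g = ⊥-elim (no-ascent (λ l → l) f mono g)

-- A sorted list is determined by its multiset of entries. Applied to letters it identifies the
-- sorted word, applied to values it gives injectivity.
monotone-↭⇒≗ : {_⊑_ : Rel A 0ℓ} → IsTotalOrder _≡_ _⊑_ → {f g : Fin n → A} →
               (∀ {i j} → i Fin.≤ j → f i ⊑ f j) → (∀ {i j} → i Fin.≤ j → g i ⊑ g j) →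
               List.tabulate f ↭ List.tabulate g → f ≗ g
monotone-↭⇒≗ {A} {n} {_⊑_} isTotalOrder {f} {g} f-mono g-mono p = Pointwise.tabulate⁻
  (↗↭↗⇒≋ O (sorted f-mono) (sorted g-mono) (↭⇒↭ₛ p))
  where
  O : TotalOrder 0ℓ 0ℓ 0ℓ
  O = record { isTotalOrder = isTotalOrder }
  pairs : ∀ {n} {h : Fin n → A} → (∀ {i j} → i Fin.≤ j → h i ⊑ h j) → AllPairs _⊑_ (List.tabulate h)
  pairs {zero} mono = []
  pairs {suc n} mono = All.tabulate⁺ (λ i → mono z≤n) ∷ pairs (mono ∘ s≤s)
  sorted = λ {h : Fin n → A} (mono : ∀ {i j} → i Fin.≤ j → h i ⊑ h j) →
    AllPairs⇒Sorted O (pairs {h = h} mono)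

-- Letter counts and the weakly increasing word of given content.

letterCount-↭ : ∀ (c : Fin a) {xs ys} → xs ↭ ys → letterCount c xs ≡ letterCount c ys
letterCount-↭ c p = ↭.↭-length (↭.filter-↭ (Fin._≟ c) p)

letterCount-positive⇒∈ : ∀ (c : Fin a) xs → 0 < letterCount c xs → c ∈ xs
letterCount-positive⇒∈ c (x ∷ xs) 0< with x Fin.≟ c
... | yes refl = here refl
... | no  _    = there (letterCount-positive⇒∈ c xs 0<)

letterCount-drop-∷ : ∀ (x c : Fin a) xs ys →
                     letterCount c (x ∷ xs) ≡ letterCount c (x ∷ ys) → letterCount c xs ≡ letterCount c ys
letterCount-drop-∷ x c xs ys eq with x Fin.≟ c
... | yes _ = ℕ.suc-injective eq
... | no  _ = eq

letterCount-∷-positive : ∀ (c : Fin a) xs → 0 < letterCount c (c ∷ xs)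
letterCount-∷-positive c xs with c Fin.≟ c
... | yes _  = z<s
... | no c≢c = ⊥-elim (c≢c refl)

-- Induction on `xs`: its first letter has positive count in `ys`, so it can be moved to the front
-- there and cancelled.
letterCount⇒↭ : ∀ (xs ys : List (Fin a)) → (∀ c → letterCount c xs ≡ letterCount c ys) → xs ↭ ys
letterCount⇒↭ [] [] eq = ↭-refl
letterCount⇒↭ [] (y ∷ ys) eq =
  ⊥-elim (ℕ.<⇒≢ (letterCount-∷-positive y ys) (eq y))
letterCount⇒↭ (x ∷ xs) ys eq
  with us , vs , refl ← ∈-∃++ (letterCount-positive⇒∈ x ys
         (subst (0 <_) (eq x) (letterCount-∷-positive x xs)))
  = ↭-trans (prep x (letterCount⇒↭ xs (us ++ vs) λ c → letterCount-drop-∷ x c xs (us ++ vs)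
      (trans (eq c) (letterCount-↭ c (↭.shift x us vs)))))
    (↭-sym (↭.shift x us vs))

-- The word `c` of the proof idea; its blocks of equal letters end at the partial sums of `r`.
sortedWord : (r : Vec ℕ a) → Vec (Fin a) (sum r)
sortedWord []      = []
sortedWord (x ∷ r) = Vec.replicate x zero Vec.++ Vec.map suc (sortedWord r)

sortedWord-content : (r : Vec ℕ a) → HasContent r (Vec.toList (sortedWord r))
sortedWord-content (zero ∷ r) c =
  trans (cong (letterCount c) (Vec.toList-map suc (sortedWord r))) (shifted c)
  where
  none : ∀ {m} (xs : List (Fin m)) → letterCount zero (map suc xs) ≡ 0
  none []       = refl
  none (x ∷ xs) = none xs
  same : ∀ {m} (c : Fin m) xs → letterCount (suc c) (map suc xs) ≡ letterCount c xs
  same c [] = refl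
  same c (x ∷ xs) with x Fin.≟ c
  ... | yes _ = cong suc (same c xs)
  ... | no  _ = same c xs
  shifted : HasContent (zero ∷ r) (map suc (Vec.toList (sortedWord r)))
  shifted zero    = none (Vec.toList (sortedWord r))
  shifted (suc c) = trans (same c (Vec.toList (sortedWord r))) (sortedWord-content r c)
sortedWord-content (suc x ∷ r) zero    = cong suc (sortedWord-content (x ∷ r) zero)
sortedWord-content (suc x ∷ r) (suc c) = sortedWord-content (x ∷ r) (suc c)

-- Half of a Galois-type correspondence between letters and positions, the other half being
-- `sortedWord-<⇒≤`. Monotonicity of `c` and both directions of the descent criterion are read off
-- from the pair.
sortedWord-≤⇒< : ∀ (r : Vec ℕ a) i t → lookup (sortedWord r) i Fin.≤ t → toℕ i < partialSum r t
sortedWord-≤⇒< (zero ∷ r) i t le = shifted t (subst (Fin._≤ t) (Vec.lookup-map i suc (sortedWord r)) le)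
  where
  shifted : ∀ t → suc (lookup (sortedWord r) i) Fin.≤ t → toℕ i < partialSum (zero ∷ r) t
  shifted (suc t) le = sortedWord-≤⇒< r i t (s≤s⁻¹ le)
sortedWord-≤⇒< (suc x ∷ r) zero    zero    le = z<s
sortedWord-≤⇒< (suc x ∷ r) zero    (suc t) le = z<s
sortedWord-≤⇒< (suc x ∷ r) (suc i) zero    le = s≤s (sortedWord-≤⇒< (x ∷ r) i zero le)
sortedWord-≤⇒< (suc x ∷ r) (suc i) (suc t) le = s≤s (sortedWord-≤⇒< (x ∷ r) i (suc t) le)

sortedWord-<⇒≤ : ∀ (r : Vec ℕ a) i t → toℕ i < partialSum r t → lookup (sortedWord r) i Fin.≤ t
sortedWord-<⇒≤ (zero ∷ r) i (suc t) lt = subst (Fin._≤ suc t)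
  (sym (Vec.lookup-map i suc (sortedWord r))) (s≤s (sortedWord-<⇒≤ r i t lt))
sortedWord-<⇒≤ (suc x ∷ r) zero    t       lt = z≤n
sortedWord-<⇒≤ (suc x ∷ r) (suc i) zero    lt = sortedWord-<⇒≤ (x ∷ r) i zero (s≤s⁻¹ lt)
sortedWord-<⇒≤ (suc x ∷ r) (suc i) (suc t) lt = sortedWord-<⇒≤ (x ∷ r) i (suc t) (s≤s⁻¹ lt)

partialSum-last : ∀ (r : Vec ℕ (suc a)) → partialSum r (Fin.fromℕ a) ≡ sum r
partialSum-last (x ∷ [])    = sym (ℕ.+-identityʳ x)
partialSum-last (x ∷ y ∷ r) = cong (x +_) (partialSum-last (y ∷ r))

-- Blocks of the sorted word, descents, and the word of a permutation.

module _ (r : Vec ℕ a) where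

  private
    c = lookup (sortedWord r)

  sortedWord-monotone : ∀ {i j} → i Fin.≤ j → c i Fin.≤ c j
  sortedWord-monotone {i} {j} i≤j =
    sortedWord-<⇒≤ r i (c j) (ℕ.≤-<-trans i≤j (sortedWord-≤⇒< r j (c j) ℕ.≤-refl))

  tabulate-sortedWord : List.tabulate c ≡ Vec.toList (sortedWord r)
  tabulate-sortedWord = trans
    (sym (toList-tabulate c)) (cong Vec.toList (Vec.tabulate∘lookup (sortedWord r)))
    where
    toList-tabulate : ∀ {n} (f : Fin n → A) → Vec.toList (Vec.tabulate f) ≡ List.tabulate f
    toList-tabulate {n = zero}  f = refl
    toList-tabulate {n = suc n} f = cong (f zero ∷_) (toList-tabulate (f ∘ suc))

  hasContent⇒↭ : ∀ {xs} → HasContent r xs → xs ↭ List.tabulate c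
  hasContent⇒↭ {xs} content = letterCount⇒↭ xs (List.tabulate c) λ t →
    trans (content t) (sym (trans (cong (letterCount t) tabulate-sortedWord) (sortedWord-content r t)))

  ↭⇒hasContent : ∀ {xs} → xs ↭ List.tabulate c → HasContent r xs
  ↭⇒hasContent p t = trans (letterCount-↭ t p)
    (trans (cong (letterCount t) tabulate-sortedWord) (sortedWord-content r t))

  sortedWord-unique : ∀ {f : Fin (sum r) → Fin a} → (∀ {i j} → i Fin.≤ j → f i Fin.≤ f j) →
                      List.tabulate f ↭ List.tabulate c → f ≗ c
  sortedWord-unique mono p = monotone-↭⇒≗ Fin.≤-isTotalOrder mono sortedWord-monotone p

  -- Descents may occur only where `c` changes its letter. In this form the descent condition can be
  -- carried along the iterates of the permutation.
  BlockMonotone : (Fin (sum r) → Fin (sum r)) → Set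
  BlockMonotone f = ∀ {i j} → i Fin.< j → c i ≡ c j → f i Fin.< f j

  -- Adjacent positions of a block are compared first; induction on the number of positions strictly
  -- between `i` and `j` chains these comparisons.
  descents⇒blockMonotone : (π : Permutation′ (sum r)) → DescentSet π ⊆ PartialSums r →
                           BlockMonotone (π ⟨$⟩ʳ_)
  descents⇒blockMonotone π desc {i} {j} i<j = go (toℕ j ∸ suc (toℕ i)) i j
    (sym (trans (sym (ℕ.+-suc _ (toℕ i))) (ℕ.m∸n+n≡m i<j)))
    where
    adjacent : ∀ i j → toℕ j ≡ suc (toℕ i) → c i ≡ c j → (π ⟨$⟩ʳ i) Fin.< (π ⟨$⟩ʳ j)
    adjacent i j j≡1+i ci≡cj with Fin.<-cmp (π ⟨$⟩ʳ i) (π ⟨$⟩ʳ j)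
    ... | tri< lt _ _ = lt
    ... | tri≈ _ eq _ = ⊥-elim (ℕ.1+n≢n (trans (sym j≡1+i) (cong toℕ (sym (permutation-injective π eq)))))
    -- A descent here would make `suc (toℕ i)` the partial sum at some `t`. Then `c i` is at most
    -- `t`, hence so is `c j`, which puts `j` before that partial sum although it is equal to it.
    ... | tri> _ _ gt with t , eq ← desc (inj₂ (i , j , refl , j≡1+i , gt)) =
      ⊥-elim (ℕ.<-irrefl j≡1+i (subst (toℕ j <_) eq (sortedWord-≤⇒< r j t
        (subst (Fin._≤ t) ci≡cj (sortedWord-<⇒≤ r i t (ℕ.≤-reflexive (sym eq)))))))
    go : ∀ m i j → toℕ j ≡ suc (m + toℕ i) → c i ≡ c j → (π ⟨$⟩ʳ i) Fin.< (π ⟨$⟩ʳ j)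
    go zero    i j j≡ eq = adjacent i j j≡ eq
    go (suc m) i j j≡ eq = Fin.<-trans (go m i k k≡ ci≡ck) (adjacent k j j≡1+k (trans (sym ci≡ck) eq))
      where
      k<n : suc (m + toℕ i) < sum r
      k<n = ℕ.<-trans (ℕ.≤-reflexive (sym j≡)) (Fin.toℕ<n j)
      k = fromℕ< k<n
      k≡ : toℕ k ≡ suc (m + toℕ i)
      k≡ = Fin.toℕ-fromℕ< k<n
      j≡1+k : toℕ j ≡ suc (toℕ k)
      j≡1+k = trans j≡ (cong suc (sym k≡))
      ci≡ck : c i ≡ c k
      ci≡ck = Fin.≤-antisym
        (sortedWord-monotone (ℕ.≤-trans (ℕ.m≤n+m _ (suc m)) (ℕ.≤-reflexive (sym k≡))))
        (ℕ.≤-trans (sortedWord-monotone (ℕ.≤-trans (ℕ.n≤1+n _) (ℕ.≤-reflexive (sym j≡1+k))))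
          (ℕ.≤-reflexive (cong toℕ (sym eq))))

  blockMonotone⇒descents : 1 ≤ a → (π : Permutation′ (sum r)) → BlockMonotone (π ⟨$⟩ʳ_) →
                           DescentSet π ⊆ PartialSums r
  blockMonotone⇒descents (s≤s _) π mono (inj₁ refl) = _ , partialSum-last r
  -- The letters at `i` and `j` differ, so the block of the letter `c i` ends exactly at `i`.
  blockMonotone⇒descents _ π mono (inj₂ (i , j , refl , j≡1+i , gt)) = c i , ℕ.≤-antisym
    (ℕ.≮⇒≥ λ lt → ci≢cj (Fin.≤-antisym (sortedWord-monotone (ℕ.<⇒≤ i<j))
      (sortedWord-<⇒≤ r j (c i) (subst (_< partialSum r (c i)) (sym j≡1+i) lt))))
    (sortedWord-≤⇒< r i (c i) ℕ.≤-refl)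
    where
    i<j : i Fin.< j
    i<j = ℕ.≤-reflexive (sym j≡1+i)
    ci≢cj : c i ≢ c j
    ci≢cj eq = ℕ.<-asym gt (mono i<j eq)

  module _ (π : Permutation′ (sum r)) (mono : BlockMonotone (π ⟨$⟩ʳ_)) where

    wordOf : Vec (Fin a) (sum r)
    wordOf = Vec.tabulate λ i → c (π ⟨$⟩ˡ i)

    lookup-wordOf : ∀ i → lookup wordOf (π ⟨$⟩ʳ i) ≡ c i
    lookup-wordOf i = trans (Vec.lookup∘tabulate _ (π ⟨$⟩ʳ i)) (cong c (inverseˡ π))

    -- Ranks compare letters first and break ties by position. Along `π` the letters of `wordOf`
    -- weakly increase, and within a block the positions increase, so the composite is strictly
    -- increasing and hence the identity.
    stFun-wordOf : ∀ i → stFun wordOf (π ⟨$⟩ʳ i) ≡ i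
    stFun-wordOf = strictlyMonotone⇒id _ λ {i} {j} i<j → s≤s⁻¹
      (subst₂ _<_ (sym (suc-stFun wordOf (π ⟨$⟩ʳ i))) (sym (suc-stFun wordOf (π ⟨$⟩ʳ j))) (rank-mono i<j))
      where
      rank-mono : ∀ {i j} → i Fin.< j → rank wordOf (π ⟨$⟩ʳ i) < rank wordOf (π ⟨$⟩ʳ j)
      rank-mono {i} {j} i<j with ℕ.m≤n⇒m<n∨m≡n (sortedWord-monotone (ℕ.<⇒≤ i<j))
      ... | inj₁ lt = rank-letter wordOf (subst₂ Fin._<_ (sym (lookup-wordOf i)) (sym (lookup-wordOf j)) lt)
      ... | inj₂ eq = rank-tie wordOf
        (trans (lookup-wordOf i) (trans (Fin.toℕ-injective eq) (sym (lookup-wordOf j))))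
        (mono i<j (Fin.toℕ-injective eq))

    st-wordOf : st wordOf ≈ flip π
    st-wordOf i = trans (cong (stFun wordOf) (sym (inverseʳ π))) (stFun-wordOf (π ⟨$⟩ˡ i))

  toList≡map-lookup : (w : Vec (Fin a) n) → Vec.toList w ≡ map (lookup w) (allFin n)
  toList≡map-lookup []      = refl
  toList≡map-lookup (x ∷ w) = cong (x ∷_) (trans (toList≡map-lookup w)
    (trans (map-tabulate id (lookup w)) (sym (map-tabulate suc (lookup (x ∷ w))))))

  module _ (π : Permutation′ (sum r)) where

    tabulate-∘-permutation : (w : Vec (Fin a) (sum r)) →
                             List.tabulate (λ i → lookup w (π ⟨$⟩ʳ i)) ↭ Vec.toList w
    tabulate-∘-permutation w = ↭-trans
      (↭-reflexive (trans (sym (map-tabulate (π ⟨$⟩ʳ_) (lookup w)))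
        (cong (map (lookup w)) (sym (map-tabulate id (π ⟨$⟩ʳ_))))))
      (↭-trans (↭.map⁺ (lookup w) (map-permutation-allFin π)) (↭-reflexive (sym (toList≡map-lookup w))))

    -- As `st w` inverts `π`, the ranks along `π` are `1, 2, …, n` in order, so the letters along
    -- `π` weakly increase; a weakly increasing word of content `r` is `c`.
    st-inverse⇒wordOf : (w : Vec (Fin a) (sum r)) → HasContent r (Vec.toList w) → st w ≈ flip π →
                        ∀ i → lookup w (π ⟨$⟩ʳ i) ≡ c i
    st-inverse⇒wordOf w content eq = sortedWord-unique mono
      (↭-trans (tabulate-∘-permutation w) (hasContent⇒↭ content))
      where
      rank-π : ∀ i → rank w (π ⟨$⟩ʳ i) ≡ suc (toℕ i)
      rank-π i = trans (sym (suc-stFun w _)) (cong (suc ∘ toℕ) (trans (eq (π ⟨$⟩ʳ i)) (inverseˡ π)))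
      mono : ∀ {i j} → i Fin.≤ j → lookup w (π ⟨$⟩ʳ i) Fin.≤ lookup w (π ⟨$⟩ʳ j)
      mono {i} {j} i≤j = ℕ.≮⇒≥ λ lt → ℕ.<⇒≱
        (s≤s⁻¹ (subst₂ _<_ (rank-π j) (rank-π i) (rank-letter w lt))) i≤j

  word : (π : PermutationWithDescentsIn (sum r) r) →
         ∃! _≡_ (λ (w : Vec (Fin a) (sum r)) → HasContent r (Vec.toList w) × st w ≈ flip (proj₁ π))
  word (π , desc) = w , (content , st-wordOf π mono) , unique
    where
    mono = descents⇒blockMonotone π desc
    w = wordOf π mono
    content : HasContent r (Vec.toList w)
    content = ↭⇒hasContent (↭-trans (↭-sym (tabulate-∘-permutation π w))
      (↭-reflexive (tabulate-cong (lookup-wordOf π mono))))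
    unique : ∀ {v} → HasContent r (Vec.toList v) × st v ≈ flip π → w ≡ v
    unique {v} (content , eq) = begin
      w ≡⟨ Vec.tabulate-cong (λ i → sym (st-inverse⇒wordOf π v content eq (π ⟨$⟩ˡ i))) ⟩
      Vec.tabulate (λ i → lookup v (π ⟨$⟩ʳ (π ⟨$⟩ˡ i)))
        ≡⟨ Vec.tabulate-cong (λ i → cong (lookup v) (inverseʳ π)) ⟩
      Vec.tabulate (lookup v)                     ≡⟨ Vec.tabulate∘lookup v ⟩
      v                                           ∎
      where open ≡-Reasoning

-- Rotations of words and readings of cycles.

rotate₁-map : ∀ (g : A → B) u → rotate₁ (List⁺.map g u) ≡ List⁺.map g (rotate₁ u)
rotate₁-map g (x ∷ [])     = refl
rotate₁-map g (x ∷ y ∷ ys) = cong (g y ∷_) (sym (map-++ g ys [ x ]))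

length-rotate₁ : ∀ (u : List⁺ A) → List⁺.length (rotate₁ u) ≡ List⁺.length u
length-rotate₁ (x ∷ [])     = refl
length-rotate₁ (x ∷ y ∷ ys) = cong suc (trans (length-++ ys) (ℕ.+-comm (length ys) 1))

rotations : List⁺ A → List (List⁺ A)
rotations u = List.iterate rotate₁ u (List⁺.length u)

-- One rotation moves the head of the list of rotations to its end, because `u` recurs after
-- `length u` steps.
rotations-∼ : ∀ {u v : List⁺ A} → u ∼ v → rotations u ↭ rotations v
rotations-∼ (zero  , refl) = ↭-refl
rotations-∼ {u = u@(x ∷ xs)} (suc k , refl) = ↭-trans
  (↭.∷↭∷ʳ u (List.iterate rotate₁ (rotate₁ u) e))
  (↭-trans (↭-reflexive once) (rotations-∼ {u = rotate₁ u} (k , refl)))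
  where
  open ≡-Reasoning
  e = length xs
  once : List.iterate rotate₁ (rotate₁ u) e ++ [ u ] ≡ rotations (rotate₁ u)
  once = begin
    List.iterate rotate₁ (rotate₁ u) e ++ [ u ]
      ≡⟨ cong (λ v → List.iterate rotate₁ (rotate₁ u) e ++ [ v ]) (rotate-length u) ⟨
    List.iterate rotate₁ (rotate₁ u) e ++ [ iterate rotate₁ (rotate₁ u) e ]
      ≡⟨ listIterate-∷ʳ rotate₁ (rotate₁ u) e ⟩
    List.iterate rotate₁ (rotate₁ u) (suc e)
      ≡⟨ cong (List.iterate rotate₁ (rotate₁ u)) (length-rotate₁ u) ⟨
    rotations (rotate₁ u) ∎

-- The device for extracting invariants from a multiset of necklaces: `R` will be `_∼_`, and `g`
-- will list a quantity over all rotations.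
concatMap-↭ : ∀ {R : Rel A 0ℓ} (g : A → List B) → (∀ {x y} → R x y → g x ↭ g y) →
              ∀ {xs ys} → Permutation R xs ys → concatMap g xs ↭ concatMap g ys
concatMap-↭ g eq (Homogeneous.refl []) = ↭-refl
concatMap-↭ g eq (Homogeneous.refl (x ∷ xs)) = ↭.++⁺ (eq x) (concatMap-↭ g eq (Homogeneous.refl xs))
concatMap-↭ g eq (Homogeneous.prep x p) = ↭.++⁺ (eq x) (concatMap-↭ g eq p)
concatMap-↭ g eq (Homogeneous.swap {x = x} {y} {x′} {y′} p q r) = ↭-trans
  (↭.shifts (g x) (g y)) (↭.++⁺ (eq q) (↭.++⁺ (eq p) (concatMap-↭ g eq r)))
concatMap-↭ g eq (Homogeneous.trans p q) = ↭-trans (concatMap-↭ g eq p) (concatMap-↭ g eq q)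

concatMap-toList-map : ∀ (g : A → B) us → 
                       concatMap List⁺.toList (map (List⁺.map g) us) ≡ map g (concatMap List⁺.toList us)
concatMap-toList-map g []       = refl
concatMap-toList-map g (u ∷ us) = trans
  (cong (map g (List⁺.toList u) ++_) (concatMap-toList-map g us))
  (sym (map-++ g (List⁺.toList u) (concatMap List⁺.toList us)))

cycleFrom-cong : ∀ {π σ : Permutation′ n} → π ≈ σ → ∀ i → cycleFrom π i ≡ cycleFrom σ i
cycleFrom-cong {n} {π} {σ} eq i = cong (λ xs → i ∷ List.takeWhile (λ j → ¬? (j Fin.≟ i)) xs)
  (trans (listIterate-cong (π ⟨$⟩ʳ i) n) (cong (λ j → List.iterate (σ ⟨$⟩ʳ_) j n) (eq i)))
  where
  listIterate-cong : ∀ x k → List.iterate (π ⟨$⟩ʳ_) x k ≡ List.iterate (σ ⟨$⟩ʳ_) x k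
  listIterate-cong x zero    = refl
  listIterate-cong x (suc k) = cong (x ∷_) (trans (listIterate-cong (π ⟨$⟩ʳ x) k)
    (cong (λ j → List.iterate (σ ⟨$⟩ʳ_) j k) (eq x)))

cycles-cong : ∀ {π σ : Permutation′ n} → π ≈ σ → cycles π ≡ cycles σ
cycles-cong {n} {π} {σ} eq = trans (map-cong same (leasts π)) (cong (map (cycleFrom σ))
  (filter-≐ _ _ ((λ {i} → subst (λ u → All (i Fin.≤_) (List⁺.toList u)) (same i)) ,
                 (λ {i} → subst (λ u → All (i Fin.≤_) (List⁺.toList u)) (sym (same i)))) (allFin n)))
  where
  same = cycleFrom-cong {π = π} {σ} eq

inverse-inverse : (ρ σ : Permutation′ n) → ρ ≈ flip σ → flip ρ ≈ σ
inverse-inverse ρ σ eq i = trans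
  (cong (ρ ⟨$⟩ˡ_) (sym (trans (eq (σ ⟨$⟩ʳ i)) (inverseˡ σ)))) (inverseˡ ρ)

module _ (π : Permutation′ n) (l : Fin n → Fin a) where

  reading : Fin n → List⁺ (Fin a)
  reading i = List⁺.map l (cycleFrom π i)

  rotate₁-reading : ∀ i → rotate₁ (reading i) ≡ reading (π ⟨$⟩ʳ i)
  rotate₁-reading i = trans (rotate₁-map l (cycleFrom π i)) (cong (List⁺.map l) (rotate₁-cycleFrom π i))

  -- Relabelling by `l ∘ π` shifts a reading by one letter. This accounts for the difference between
  -- reading cycles through `w`, as `U` does, and through `c`.
  reading-∘ : ∀ {m : Fin n → Fin a} → (∀ i → l (π ⟨$⟩ʳ i) ≡ m i) →
              ∀ i → rotate₁ (reading i) ≡ List⁺.map m (cycleFrom π i)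
  reading-∘ {m} eq i = trans (rotate₁-reading i) (toList-injective (begin
    map l (List⁺.toList (cycleFrom π (f i)))       ≡⟨ cong (map l) (toList-cycleFrom π (f i)) ⟩
    map l (List.iterate f (f i) (List⁺.length (cycleFrom π (f i))))
      ≡⟨ cong (λ d → map l (List.iterate f (f i) d)) (isPeriod-unique (cycleFrom-period π (f i))
           (isPeriod-step (permutation-injective π) (cycleFrom-period π i))) ⟩
    map l (List.iterate f (f i) (List⁺.length (cycleFrom π i)))
      ≡⟨ map-listIterate f (λ _ → refl) (λ x → sym (eq x)) i (List⁺.length (cycleFrom π i)) ⟨
    map m (List.iterate f i (List⁺.length (cycleFrom π i))) ≡⟨ cong (map m) (toList-cycleFrom π i) ⟨
    map m (List⁺.toList (cycleFrom π i))           ∎))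
    where
    open ≡-Reasoning
    f = π ⟨$⟩ʳ_

-- Infinite words encoded as numbers.

-- The number with base-a digits letter x, letter (step x), …, letter (stepᵏ⁻¹ x):
-- comparing these numbers compares the words lexicographically.
value : (A → A) → (A → Fin a) → ℕ → A → ℕ
value         step letter zero    x = 0
value {a = a} step letter (suc k) x = toℕ (letter x) * a ^ k + value step letter k (step x)

-- A remainder below `b` cannot make up for a smaller quotient.
lex-< : ∀ {q q′ s s′ b} → q < q′ → s < b → q * b + s < q′ * b + s′
lex-< {q} {q′} {s} {s′} {b} q<q′ s<b = begin-strict
  q * b + s     <⟨ ℕ.+-monoʳ-< (q * b) s<b ⟩
  q * b + b     ≡⟨ ℕ.+-comm (q * b) b ⟩
  suc q * b     ≤⟨ ℕ.*-monoˡ-≤ b q<q′ ⟩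
  q′ * b        ≤⟨ ℕ.m≤m+n (q′ * b) s′ ⟩
  q′ * b + s′   ∎
  where open ℕ.≤-Reasoning

-- Uniqueness of quotient and remainder.
lex-≡ : ∀ {q q′ s s′ b} → s < b → s′ < b → q * b + s ≡ q′ * b + s′ → q ≡ q′ × s ≡ s′
lex-≡ {q} {q′} {b = b} s<b s′<b eq with ℕ.<-cmp q q′
... | tri< lt _ _ = ⊥-elim (ℕ.<⇒≢ (lex-< lt s<b) eq)
... | tri≈ _ refl _ = refl , ℕ.+-cancelˡ-≡ (q * b) _ _ eq
... | tri> _ _ gt = ⊥-elim (ℕ.<⇒≢ (lex-< gt s′<b) (sym eq))

value-commute : ∀ {f : A → A} {g : B → B} {p : A → Fin a} {q : B → Fin a} (h : A → B) →
                (∀ x → h (f x) ≡ g (h x)) → (∀ x → p x ≡ q (h x)) →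
                ∀ k x → value f p k x ≡ value g q k (h x)
value-commute h eq eq′ zero x = refl
value-commute {a = a} {g = g} {q = q} h eq eq′ (suc k) x =
  cong₂ _+_ (cong (λ c → toℕ c * a ^ k) (eq′ x))
    (trans (value-commute h eq eq′ k _) (cong (value g q k) (eq x)))

module _ (step : A → A) (letter : A → Fin a) where

  private
    val = value step letter

  value-< : ∀ k x → val k x < a ^ k
  value-< zero    x = z<s
  value-< (suc k) x = ℕ.<-≤-trans
    (lex-< {s′ = 0} (Fin.toℕ<n (letter x)) (value-< k (step x)))
    (ℕ.≤-reflexive (ℕ.+-identityʳ _))

  value-suc : ∀ k x → val (suc k) x ≡ val k x * a + toℕ (letter (iterate step x k))
  value-suc zero    x = trans (ℕ.+-identityʳ _) (ℕ.*-identityʳ _)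
  value-suc (suc k) x = begin
    l * (a * a ^ k) + val (suc k) (step x)
      ≡⟨ cong (l * (a * a ^ k) +_) (value-suc k (step x)) ⟩
    l * (a * a ^ k) + (val k (step x) * a + last)               ≡⟨ ℕ.+-assoc (l * (a * a ^ k)) _ _ ⟨
    l * (a * a ^ k) + val k (step x) * a + last
      ≡⟨ cong (λ m → m + val k (step x) * a + last)
           (trans (cong (l *_) (ℕ.*-comm a (a ^ k))) (sym (ℕ.*-assoc l (a ^ k) a))) ⟩
    l * a ^ k * a + val k (step x) * a + last
      ≡⟨ cong (_+ last) (ℕ.*-distribʳ-+ a (l * a ^ k) _) ⟨
    (l * a ^ k + val k (step x)) * a + last                     ∎
    where
    open ≡-Reasoning
    l = toℕ (letter x)
    last = toℕ (letter (iterate step (step x) k))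

  -- Both sides are `val (suc N) x`, split at its last digit and at its first; by periodicity the
  -- last digit is again the letter of `x`. So the shift by one letter becomes arithmetic on values
  -- with the same number of digits.
  value-step : ∀ {N x} → iterate step x N ≡ x →
               val N x * a + toℕ (letter x) ≡ toℕ (letter x) * a ^ N + val N (step x)
  value-step {N} {x} ret = trans
    (cong (λ y → val N x * a + toℕ (letter y)) (sym ret)) (sym (value-suc N x))

  -- The word started at `step x` comes round to `x` at its `N`-th letter, so the value of a
  -- successor reveals the letter of the point itself.
  value-step-last : ∀ {N x} → 0 < N → iterate step x N ≡ x →
                    ∃ λ q → val N (step x) ≡ q * a + toℕ (letter x)
  value-step-last {suc N} {x} _ ret = val N (step x) ,
    trans (value-suc N (step x)) (cong (λ y → val N (step x) * a + toℕ (letter y)) ret)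

  value-≡-suc : ∀ k {x y} → val (suc k) x ≡ val (suc k) y →
                letter x ≡ letter y × val k (step x) ≡ val k (step y)
  value-≡-suc k eq with e , e′ ← lex-≡ (value-< k _) (value-< k _) eq = Fin.toℕ-injective e , e′

  value-≡-letter : ∀ {N x y} → 0 < N → val N x ≡ val N y → letter x ≡ letter y
  value-≡-letter {suc k} _ eq = proj₁ (value-≡-suc k eq)

-- Primitivity of the necklaces and injectivity.

module _ (r : Vec ℕ a) where

  private
    c = lookup (sortedWord r)
    -- A common period of all the infinite words, so that N letters determine them.
    N = sum r !

    0<N : 0 < N
    0<N = ℕ.1≤n! (sum r)

  valueOf : Permutation′ (sum r) → ℕ → Fin (sum r) → ℕ
  valueOf π = value (π ⟨$⟩ʳ_) c

  -- If rotation by `k` fixes the reading at `i`, then `i` and its `k`-th iterate `j` start the same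
  -- label word. The `k`-th iterate of `f` preserves strict order on such pairs, so `i ≢ j` would
  -- start an endless strictly monotone orbit, while `i ≡ j` contradicts the cycle length.
  reading-primitive : (π : Permutation′ (sum r)) → BlockMonotone r (π ⟨$⟩ʳ_) →
                      ∀ {l} → (∀ i → l (π ⟨$⟩ʳ i) ≡ c i) → ∀ i → Primitive (reading π l i)
  reading-primitive π mono {l} lf≡c i k 0<k k<len eq = contra
    where
    f = π ⟨$⟩ʳ_
    -- Agreement of the whole label words is required so that the relation survives a step of `f`;
    -- the label after one step is the letter of `c` needed for block monotonicity.
    SameLetters< : Rel (Fin (sum r)) 0ℓ
    SameLetters< x y = (∀ m → l (iterate f x m) ≡ l (iterate f y m)) × x Fin.< y
    step-mono : ∀ {x y} → SameLetters< x y → SameLetters< (f x) (f y)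
    step-mono {x} {y} (same , x<y) = same ∘ suc ,
      mono x<y (trans (sym (lf≡c x)) (trans (same 1) (lf≡c y)))
    iterate-mono : ∀ k {x y} → SameLetters< x y → SameLetters< (iterate f x k) (iterate f y k)
    iterate-mono zero    s = s
    iterate-mono (suc k) s = iterate-mono k (step-mono s)
    head-rotate : ∀ m x → l (iterate f x m) ≡ List⁺.head (rotate m (reading π l x))
    head-rotate m x = cong List⁺.head (iterate-commute (reading π l) (λ y → sym (rotate₁-reading π l y)) x m)
    j = iterate f i k
    same : ∀ m → l (iterate f j m) ≡ l (iterate f i m)
    same m = trans (head-rotate m j) (trans (cong (λ u → List⁺.head (rotate m u))
      (trans (iterate-commute (reading π l) (λ y → sym (rotate₁-reading π l y)) i k) eq))
      (sym (head-rotate m i)))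
    contra : ⊥
    contra with Fin.<-cmp i j
    ... | tri< lt _ _ = no-ascent proj₂ (λ x → iterate f x k) (iterate-mono k) ((λ m → sym (same m)) , lt)
    ... | tri> _ _ gt = no-descent proj₂ (λ x → iterate f x k) (iterate-mono k) (same , gt)
    ... | tri≈ _ i≡j _ = IsPeriod.first (cycleFrom-period π i) k 0<k
      (subst (k <_) (cong suc (length-map l (List⁺.tail (cycleFrom π i)))) k<len) (sym i≡j)

  -- If the leading letters differ they decide, as `c` is weakly increasing; if they agree, block
  -- monotonicity keeps the order for the remaining `k` letters.
  valueOf-monotone : (π : Permutation′ (sum r)) → BlockMonotone r (π ⟨$⟩ʳ_) →
                     ∀ k {i j} → i Fin.≤ j → valueOf π k i ≤ valueOf π k j
  valueOf-monotone π mono zero    i≤j = z≤n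
  valueOf-monotone π mono (suc k) {i} {j} i≤j with ℕ.m≤n⇒m<n∨m≡n i≤j
  ... | inj₂ eq = ℕ.≤-reflexive (cong (valueOf π (suc k)) (Fin.toℕ-injective eq))
  ... | inj₁ i<j with ℕ.m≤n⇒m<n∨m≡n (sortedWord-monotone r i≤j)
  ...   | inj₁ lt = ℕ.<⇒≤ (lex-< lt (value-< (π ⟨$⟩ʳ_) c k _))
  ...   | inj₂ eq = ℕ.+-mono-≤ (ℕ.≤-reflexive (cong (_* a ^ k) eq))
    (valueOf-monotone π mono k (ℕ.<⇒≤ (mono i<j (Fin.toℕ-injective eq))))

  -- Computed from the necklace alone and, up to order, independent of where it is cut open. For a
  -- cycle read through `c` it lists `valueOf` at the points of the cycle.
  values : List⁺ (Fin a) → List ℕ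
  values u = map (value rotate₁ List⁺.head N) (rotations u)

  readings : Permutation′ (sum r) → List (List⁺ (Fin a))
  readings π = map (List⁺.map c) (cycles π)

  values-readings : (π : Permutation′ (sum r)) → concatMap values (readings π) ↭ List.tabulate (valueOf π N)
  values-readings π = ↭-trans (↭-reflexive (along (leasts π))) (↭-trans
    (↭.map⁺ (valueOf π N) (concat-cycles π)) (↭-reflexive (map-tabulate id (valueOf π N))))
    where
    open ≡-Reasoning
    f = π ⟨$⟩ʳ_
    each : ∀ i → values (reading π c i) ≡ map (valueOf π N) (List⁺.toList (cycleFrom π i))
    each i = begin
      values (reading π c i)
        ≡⟨ map-listIterate (reading π c) (λ x → sym (rotate₁-reading π c x))
             (value-commute (reading π c) (λ x → sym (rotate₁-reading π c x)) (λ _ → refl) N)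
             i (List⁺.length (reading π c i)) ⟨
      map (valueOf π N) (List.iterate f i (List⁺.length (reading π c i)))
        ≡⟨ cong (λ d → map (valueOf π N) (List.iterate f i (suc d))) (length-map c (List⁺.tail (cycleFrom π i))) ⟩
      map (valueOf π N) (List.iterate f i (List⁺.length (cycleFrom π i)))
        ≡⟨ cong (map (valueOf π N)) (toList-cycleFrom π i) ⟨
      map (valueOf π N) (List⁺.toList (cycleFrom π i)) ∎
    along : ∀ is → concatMap values (map (List⁺.map c) (map (cycleFrom π) is)) ≡
                   map (valueOf π N) (concatMap List⁺.toList (map (cycleFrom π) is))
    along []       = refl
    along (i ∷ is) = trans (cong₂ _++_ (each i) (along is))
      (sym (map-++ (valueOf π N) (List⁺.toList (cycleFrom π i)) _))

  module _ (π σ : Permutation′ (sum r))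
           (π-mono : BlockMonotone r (π ⟨$⟩ʳ_)) (σ-mono : BlockMonotone r (σ ⟨$⟩ʳ_)) where

    -- The multiset of values depends only on the necklaces, and `valueOf` is weakly increasing in
    -- the position, so sorting that multiset recovers it pointwise.
    readings-↭⇒valueOf-≗ : Permutation _∼_ (readings π) (readings σ) → valueOf π N ≗ valueOf σ N
    readings-↭⇒valueOf-≗ p = monotone-↭⇒≗ ℕ.≤-isTotalOrder
      (valueOf-monotone π π-mono N) (valueOf-monotone σ σ-mono N)
      (↭-trans (↭-sym (values-readings π)) (↭-trans
        (concatMap-↭ values (λ u∼v → ↭.map⁺ (value rotate₁ List⁺.head N) (rotations-∼ u∼v)) p)
        (values-readings σ)))

    -- τ = σ⁻¹π preserves values and is increasing where they tie, so a point
    -- moved by τ would have an infinite strictly monotone orbit.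
    valueOf-≗⇒≈ : valueOf π N ≗ valueOf σ N → π ≈ σ
    valueOf-≗⇒≈ eq i = trans (sym (inverseʳ σ)) (cong (σ ⟨$⟩ʳ_) fixed)
      where
      τ : Fin (sum r) → Fin (sum r)
      τ x = σ ⟨$⟩ˡ (π ⟨$⟩ʳ x)
      τ-injective : ∀ {x y} → τ x ≡ τ y → x ≡ y
      τ-injective e = permutation-injective π (permutation-injective (flip σ) e)
      letter : ∀ {x y} → valueOf σ N x ≡ valueOf σ N y → c x ≡ c y
      letter = value-≡-letter (σ ⟨$⟩ʳ_) c 0<N
      στ≡π : ∀ x → valueOf σ N (σ ⟨$⟩ʳ τ x) ≡ valueOf π N (π ⟨$⟩ʳ x)
      στ≡π x = trans (cong (valueOf σ N) (inverseʳ σ)) (sym (eq (π ⟨$⟩ʳ x)))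
      -- The letter of a point is the last base-`a` digit of the value of its successor.
      τ-letter : ∀ x → c (τ x) ≡ c x
      τ-letter x =
        let q  , e  = value-step-last (σ ⟨$⟩ʳ_) c 0<N (iterate-! (permutation-injective σ) (τ x))
            q′ , e′ = value-step-last (π ⟨$⟩ʳ_) c 0<N (iterate-! (permutation-injective π) x)
        in Fin.toℕ-injective (proj₂ (lex-≡ {q} {q′} (Fin.toℕ<n (c (τ x))) (Fin.toℕ<n (c x))
             (trans (sym e) (trans (στ≡π x) e′))))
      -- `value-step` recovers the value of a point from its letter and the value of its successor.
      τ-value : ∀ x → valueOf σ N (τ x) ≡ valueOf σ N x
      τ-value x = trans (proj₁ (lex-≡ (Fin.toℕ<n (c (τ x))) (Fin.toℕ<n (c x)) (begin
        valueOf σ N (τ x) * a + toℕ (c (τ x))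
          ≡⟨ value-step (σ ⟨$⟩ʳ_) c {N} (iterate-! (permutation-injective σ) (τ x)) ⟩
        toℕ (c (τ x)) * a ^ N + valueOf σ N (σ ⟨$⟩ʳ τ x)
          ≡⟨ cong₂ (λ l v → toℕ l * a ^ N + v) (τ-letter x) (στ≡π x) ⟩
        toℕ (c x) * a ^ N + valueOf π N (π ⟨$⟩ʳ x)
          ≡⟨ value-step (π ⟨$⟩ʳ_) c {N} (iterate-! (permutation-injective π) x) ⟨
        valueOf π N x * a + toℕ (c x) ∎))) (eq x)
        where open ≡-Reasoning
      SameValue< : Rel (Fin (sum r)) 0ℓ
      SameValue< x y = valueOf σ N x ≡ valueOf σ N y × x Fin.< y
      τ-mono : ∀ {x y} → SameValue< x y → SameValue< (τ x) (τ y)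
      τ-mono {x} {y} (e , x<y) = e′ , τx<τy
        where
        e′ = trans (τ-value x) (trans e (sym (τ-value y)))
        τx<τy : τ x Fin.< τ y
        τx<τy with Fin.<-cmp (τ x) (τ y)
        ... | tri< lt _ _ = lt
        ... | tri≈ _ eq _ = ⊥-elim (Fin.<⇒≢ x<y (τ-injective eq))
        -- If `τ y` came before `τ x`, then `σ`, increasing on ties, would put `π y` before `π x`,
        -- against `π-mono`.
        ... | tri> _ _ gt = ⊥-elim (Fin.<-asym (π-mono x<y (letter e))
          (subst₂ Fin._<_ (inverseʳ σ) (inverseʳ σ) (σ-mono gt (letter (sym e′)))))
      fixed : τ i ≡ i
      fixed with Fin.<-cmp (τ i) i
      ... | tri< lt _ _ = ⊥-elim (no-descent {R = SameValue<} proj₂ τ τ-mono (τ-value i , lt))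
      ... | tri≈ _ e _  = e
      ... | tri> _ _ gt = ⊥-elim (no-ascent {R = SameValue<} proj₂ τ τ-mono (sym (τ-value i) , gt))

-- Sorting by a key, and periods of primitive words.

sortBy : ∀ (key : A → ℕ) (xs : List A) → length xs ≡ n →
         ∃ λ (x : Fin n → A) → List.tabulate x ↭ xs × (∀ {i j} → i Fin.≤ j → key (x i) ≤ key (x j))
sortBy {A} key xs refl = enumerate (sort xs) (↭.↭-length (sort-↭ xs)) (sort-↭ xs)
  (lookup-mono-≤ (DecTotalOrder.totalOrder O) (sort-↗ xs))
  where
  O = On.decTotalOrder ℕ.≤-decTotalOrder key
  open Sort O
  enumerate : ∀ {n} ys → length ys ≡ n → ys ↭ xs →
              (∀ {i j} → i Fin.≤ j → key (List.lookup ys i) ≤ key (List.lookup ys j)) →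
              ∃ λ (x : Fin n → A) → List.tabulate x ↭ xs × (∀ {i j} → i Fin.≤ j → key (x i) ≤ key (x j))
  enumerate ys refl p mono = List.lookup ys , ↭-trans (↭-reflexive (tabulate-lookup ys)) p , mono

unique-resp-↭ : ∀ {xs ys : List A} → xs ↭ ys → Unique xs → Unique ys
unique-resp-↭ p = ↭ₛ.Unique-resp-↭ (setoid _) (↭⇒↭ₛ p)

unique-tabulate⁻ : ∀ {x : Fin n → A} → Unique (List.tabulate x) → Injective _≡_ _≡_ x
unique-tabulate⁻ u         {zero}  {zero}  eq = refl
unique-tabulate⁻ (x≢ ∷ u) {zero}  {suc j} eq = ⊥-elim (All.tabulate⁻ x≢ j eq)
unique-tabulate⁻ (x≢ ∷ u) {suc i} {zero}  eq = ⊥-elim (All.tabulate⁻ x≢ i (sym eq))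
unique-tabulate⁻ (x≢ ∷ u) {suc i} {suc j} eq = cong suc (unique-tabulate⁻ u eq)

unique-map : ∀ (f : A → B) {xs} → (∀ {x y} → x ∈ xs → y ∈ xs → f x ≡ f y → x ≡ y) →
             Unique xs → Unique (map f xs)
unique-map f inj [] = []
unique-map f inj (x≢ ∷ u) =
  All.map⁺ (All.tabulate λ y∈ eq → All.lookup x≢ y∈ (inj (here refl) (there y∈) eq)) ∷
  unique-map f (λ x∈ y∈ → inj (there x∈) (there y∈)) u

-- The other `length xs` single rotations of a full turn undo the first one, and words with equal
-- rotations have equal lengths.
rotate₁-injective : Injective _≡_ _≡_ (rotate₁ {A})
rotate₁-injective {x = u@(x ∷ xs)} {v@(y ∷ ys)} eq = begin
  u                               ≡⟨ rotate-length u ⟨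
  rotate (length xs) (rotate₁ u)
    ≡⟨ cong₂ rotate (ℕ.suc-injective
         (trans (sym (length-rotate₁ u)) (trans (cong List⁺.length eq) (length-rotate₁ v)))) eq ⟩
  rotate (length ys) (rotate₁ v)  ≡⟨ rotate-length v ⟩
  v                               ∎
  where open ≡-Reasoning

∼-length : ∀ {u v : List⁺ A} → u ∼ v → List⁺.length u ≡ List⁺.length v
∼-length         (zero  , refl) = refl
∼-length {u = u} (suc k , refl) = trans (sym (length-rotate₁ u)) (∼-length {u = rotate₁ u} (k , refl))

∼-rotate₁ : ∀ {u v : List⁺ A} → u ∼ v → u ∼ rotate₁ v
∼-rotate₁ {u = u} (k , refl) = suc k , iterate-suc rotate₁ u k

map-head-rotations : ∀ (u : List⁺ A) → map List⁺.head (rotations u) ≡ List⁺.toList u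
map-head-rotations u@(x ∷ xs) = prefix (x ∷ xs) u (sym (++-identityʳ (x ∷ xs)))
  where
  -- Generalized to an initial segment `xs` of `u`: a rotated letter goes to the far end and leaves
  -- the rest of the segment intact.
  prefix : ∀ xs {ys} u → List⁺.toList u ≡ xs ++ ys →
           map List⁺.head (List.iterate rotate₁ u (length xs)) ≡ xs
  prefix []       u        eq   = refl
  prefix (x ∷ xs) {ys} u@(_ ∷ _) refl = cong (x ∷_) (prefix xs {ys ++ [ x ]} (rotate₁ u)
    (trans (toList-rotate 1 u) (++-assoc xs ys [ x ])))

-- Primitivity says that the length of `u` is its least period; injectivity of `rotate₁` carries
-- least periods over to all rotations.
primitive⇒isPeriod : ∀ {u v : List⁺ A} → Primitive u → u ∼ v → IsPeriod rotate₁ v (List⁺.length v)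
primitive⇒isPeriod {u = u} prim u∼v@(k , refl) =
  subst (IsPeriod rotate₁ _) (∼-length {u = u} u∼v) (along k base)
  where
  base : IsPeriod rotate₁ u (List⁺.length u)
  base .positive = z<s
  base .returns  = rotate-length u
  base .first    = prim
  along : ∀ k {v d} → IsPeriod rotate₁ v d → IsPeriod rotate₁ (rotate k v) d
  along zero    p = p
  along (suc k) p = along k (isPeriod-step rotate₁-injective p)

value-≡-prefix : ∀ (step : A → A) (letter : A → Fin a) {N k x y} → k ≤ N →
                 value step letter N x ≡ value step letter N y →
                 map letter (List.iterate step x k) ≡ map letter (List.iterate step y k)
value-≡-prefix step letter {k = zero} k≤N eq = refl
value-≡-prefix step letter {suc N} {suc k} (s≤s k≤N) eq =
  let e , e′ = value-≡-suc step letter N eq in cong₂ _∷_ e (value-≡-prefix step letter k≤N e′)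

length≤length-concatMap : ∀ {u : List⁺ A} {us} → u ∈ us → List⁺.length u ≤ length (concatMap List⁺.toList us)
length≤length-concatMap {us = u ∷ us} (here refl) =
  ℕ.≤-trans (ℕ.m≤m+n _ _) (ℕ.≤-reflexive (sym (length-++ (List⁺.toList u))))
length≤length-concatMap {us = u ∷ us} (there u∈) =
  ℕ.≤-trans (length≤length-concatMap u∈) (ℕ.≤-trans (ℕ.m≤n+m _ (List⁺.length u))
    (ℕ.≤-reflexive (sym (length-++ (List⁺.toList u)))))

-- Surjectivity: a permutation built from a multiset of primitive necklaces.

module Construction (r : Vec ℕ a) (us : List (List⁺ (Fin a))) (prim : All Primitive us)
                    (content : HasContent r (concatMap List⁺.toList us)) where

  private
    c = lookup (sortedWord r)
    N = sum r !
    m = length us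
    open ≡-Reasoning

    necklace : Fin m → List⁺ (Fin a)
    necklace = List.lookup us

  -- A letter occurrence in us: the index of its necklace and the rotation that starts there.
  Occurrence : Set
  Occurrence = Fin m × List⁺ (Fin a)

  Valid : Pred Occurrence 0ℓ
  Valid (b , v) = necklace b ∼ v

  letter : Occurrence → Fin a
  letter (b , v) = List⁺.head v

  next : Occurrence → Occurrence
  next (b , v) = b , rotate₁ v

  occurrences : List Occurrence
  occurrences = concatMap (λ b → map (b ,_) (rotations (necklace b))) (allFin m)

  ∈-occurrences⁺ : ∀ {s} → Valid s → s ∈ occurrences
  ∈-occurrences⁺ {b , v} (k , refl) = ∈-concatMap⁺ (λ b → map (b ,_) (rotations (necklace b)))
    (lose (∈-allFin b) (∈-map⁺ (b ,_) (∈-listIterate⁺ rotate₁ (rotate-length (necklace b)) z<s k)))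

  ∈-occurrences⁻ : ∀ {s} → s ∈ occurrences → Valid s
  ∈-occurrences⁻ s∈
    with b , _ , s∈b ← find (∈-concatMap⁻ (λ b → map (b ,_) (rotations (necklace b))) {xs = allFin m} s∈)
    with v , v∈ , refl ← ∈-map⁻ (b ,_) s∈b = ∈-listIterate⁻ rotate₁ (List⁺.length (necklace b)) v∈

  -- Primitivity keeps the rotations of one necklace distinct, and the index separates equal
  -- necklaces of the multiset.
  occurrences-unique : Unique occurrences
  occurrences-unique = Unique.concat⁺
    (All.map⁺ (All.universal each (allFin m)))
    (AllPairs.map⁺ (AllPairs.map disjoint (Unique.allFin⁺ m)))
    where
    each : ∀ b → Unique (map (b ,_) (rotations (necklace b)))
    each b = Unique.map⁺ (λ { refl → refl })
      (unique-listIterate (primitive⇒isPeriod (All.lookup prim (∈-lookup b)) (0 , refl)))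
    disjoint : ∀ {b b′} → b ≢ b′ → ∀ {s} →
               ¬ (s ∈ map (b ,_) (rotations (necklace b)) × s ∈ map (b′ ,_) (rotations (necklace b′)))
    disjoint b≢b′ (s∈ , s∈′) with _ , _ , refl ← ∈-map⁻ _ s∈ | _ , _ , refl ← ∈-map⁻ _ s∈′ = b≢b′ refl

  map-letter-occurrences : map letter occurrences ≡ concatMap List⁺.toList us
  map-letter-occurrences = begin
    map letter occurrences
      ≡⟨ map-concatMap letter (λ b → map (b ,_) (rotations (necklace b))) (allFin m) ⟩
    concatMap (λ b → map letter (map (b ,_) (rotations (necklace b)))) (allFin m)
      ≡⟨ concatMap-cong (λ b → trans (sym (map-∘ (rotations (necklace b)))) (map-head-rotations (necklace b))) (allFin m) ⟩
    concatMap (λ b → List⁺.toList (necklace b)) (allFin m)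
      ≡⟨ concatMap-map List⁺.toList necklace (allFin m) ⟨
    concatMap List⁺.toList (map necklace (allFin m))
      ≡⟨ cong (concatMap List⁺.toList) (trans (map-tabulate id necklace) (tabulate-lookup us)) ⟩
    concatMap List⁺.toList us ∎

  length-content : length (concatMap List⁺.toList us) ≡ sum r
  length-content = trans
    (↭.↭-length (hasContent⇒↭ r {concatMap List⁺.toList us} content)) (length-tabulate c)

  length≤n : ∀ {s} → Valid s → List⁺.length (proj₂ s) ≤ sum r
  length≤n {b , v} b∼v = subst₂ _≤_ (∼-length {u = necklace b} b∼v) length-content
    (length≤length-concatMap (∈-lookup {xs = us} b))

  length∣N : ∀ {s} → Valid s → List⁺.length (proj₂ s) ∣ N
  length∣N {b , v} b∼v = ∣-trans (m∣m*n (length (List⁺.tail v) !)) (m≤n⇒m!∣n! (length≤n b∼v))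

  rotate-N : ∀ {s} → Valid s → rotate N (proj₂ s) ≡ proj₂ s
  rotate-N {b , v} b∼v = iterate-∣ rotate₁ (rotate-length v) (length∣N b∼v)

  necklaceValue : List⁺ (Fin a) → ℕ
  necklaceValue = value rotate₁ List⁺.head N

  -- Orders occurrences by the infinite words they start, ties being broken by the index.
  key : Occurrence → ℕ
  key (b , v) = necklaceValue v * m + toℕ b

  -- Division by `m` separates the value from the index. Equal indices force equal lengths, and the
  -- `N` letters of a value cover at least one full turn, so they determine the rotation.
  key-injective : ∀ {s t} → Valid s → Valid t → key s ≡ key t → s ≡ t
  key-injective {b , v} {b′ , v′} ps pt eq
    with lex-≡ {q = necklaceValue v} {necklaceValue v′} (Fin.toℕ<n b) (Fin.toℕ<n b′) eq
  ... | v≡ , b≡ with refl ← Fin.toℕ-injective b≡ = cong (b ,_) (toList-injective (begin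
    List⁺.toList v                                                    ≡⟨ map-head-rotations v ⟨
    map List⁺.head (rotations v)
      ≡⟨ value-≡-prefix rotate₁ List⁺.head
           (∣⇒≤ {{ sum r ℕ.!≢0 }} (length∣N ps)) v≡ ⟩
    map List⁺.head (List.iterate rotate₁ v′ (List⁺.length v))
      ≡⟨ cong (λ d → map List⁺.head (List.iterate rotate₁ v′ d))
           (trans (sym (∼-length {u = necklace b} ps)) (∼-length {u = necklace b} pt)) ⟩
    map List⁺.head (rotations v′)                               ≡⟨ map-head-rotations v′ ⟩
    List⁺.toList v′                                                   ∎))

  key-letter : ∀ {s t} → letter s Fin.< letter t → key s < key t
  key-letter {b , v} {b′ , v′} lt = lex-< (value-letter (ℕ.1≤n! (sum r))) (Fin.toℕ<n b)
    where
    value-letter : ∀ {k} → 0 < k → value rotate₁ List⁺.head k v < value rotate₁ List⁺.head k v′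
    value-letter {suc k} _ = lex-< lt (value-< rotate₁ List⁺.head k (rotate₁ v))

  -- By `value-step`, dropping a common first letter preserves both strict inequality and equality
  -- of values. When the values are equal the index decides, and `next` does not change it.
  key-next : ∀ {s t} → Valid s → Valid t → letter s ≡ letter t → key s < key t →
             key (next s) < key (next t)
  key-next {b , v} {b′ , v′} ps pt eq lt with ℕ.<-cmp (necklaceValue v) (necklaceValue v′)
  ... | tri> _ _ gt = ⊥-elim (ℕ.<-asym lt (lex-< gt (Fin.toℕ<n b′)))
  ... | tri< v< _ _ = lex-< (ℕ.+-cancelˡ-< (toℕ (letter (b′ , v′)) * a ^ N) _ _
    (subst₂ _<_
      (trans (value-step rotate₁ List⁺.head {N} (rotate-N ps))
        (cong (λ l → toℕ l * a ^ N + necklaceValue (rotate₁ v)) eq))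
      (value-step rotate₁ List⁺.head {N} (rotate-N pt))
      (lex-< v< (Fin.toℕ<n (List⁺.head v))))) (Fin.toℕ<n b)
  ... | tri≈ _ v≡ _ = subst (λ q → key (next (b , v)) < q * m + toℕ b′) next≡
    (ℕ.+-monoʳ-< (necklaceValue (rotate₁ v) * m)
      (ℕ.+-cancelˡ-< (necklaceValue v * m) _ _ (subst (λ q → key (b , v) < q * m + toℕ b′) (sym v≡) lt)))
    where
    next≡ : necklaceValue (rotate₁ v) ≡ necklaceValue (rotate₁ v′)
    next≡ = ℕ.+-cancelˡ-≡ (toℕ (List⁺.head v) * a ^ N) _ _ (begin
      toℕ (List⁺.head v) * a ^ N + necklaceValue (rotate₁ v)
        ≡⟨ value-step rotate₁ List⁺.head {N} (rotate-N ps) ⟨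
      necklaceValue v * a + toℕ (List⁺.head v)
        ≡⟨ cong₂ (λ q l → q * a + toℕ l) v≡ eq ⟩
      necklaceValue v′ * a + toℕ (List⁺.head v′)
        ≡⟨ value-step rotate₁ List⁺.head {N} (rotate-N pt) ⟩
      toℕ (List⁺.head v′) * a ^ N + necklaceValue (rotate₁ v′)
        ≡⟨ cong (λ l → toℕ l * a ^ N + necklaceValue (rotate₁ v′)) eq ⟨
      toℕ (List⁺.head v) * a ^ N + necklaceValue (rotate₁ v′)   ∎)

  private
    sorted = sortBy key occurrences
      (trans (trans (sym (length-map letter occurrences)) (cong length map-letter-occurrences))
        length-content)

  nth : Fin (sum r) → Occurrence
  nth = proj₁ sorted

  nth-↭ : List.tabulate nth ↭ occurrences
  nth-↭ = proj₁ (proj₂ sorted)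

  nth-monotone : ∀ {i j} → i Fin.≤ j → key (nth i) ≤ key (nth j)
  nth-monotone = proj₂ (proj₂ sorted)

  nth-injective : Injective _≡_ _≡_ nth
  nth-injective = unique-tabulate⁻ (unique-resp-↭ (↭-sym nth-↭) occurrences-unique)

  nth-valid : ∀ i → Valid (nth i)
  nth-valid i = ∈-occurrences⁻ (↭.∈-resp-↭ nth-↭ (∈-tabulate⁺ i))

  nth-surjective : ∀ {s} → Valid s → ∃ λ i → s ≡ nth i
  nth-surjective ps = ∈-tabulate⁻ (↭.∈-resp-↭ (↭-sym nth-↭) (∈-occurrences⁺ ps))

  nth-strict : ∀ {i j} → i Fin.< j → key (nth i) < key (nth j)
  nth-strict {i} {j} i<j = ℕ.≤∧≢⇒< (nth-monotone (ℕ.<⇒≤ i<j))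
    λ eq → Fin.<⇒≢ i<j (nth-injective (key-injective (nth-valid i) (nth-valid j) eq))

  -- Keys compare letters first, so sorting by key makes the letters weakly increasing, and their
  -- total content is `r`.
  nth-letter : ∀ i → letter (nth i) ≡ c i
  nth-letter = sortedWord-unique r
    (λ i≤j → ℕ.≮⇒≥ λ gt → ℕ.<⇒≱ (key-letter gt) (nth-monotone i≤j))
    (↭-trans (↭-reflexive (sym (map-tabulate nth letter))) (↭-trans (↭.map⁺ letter nth-↭)
      (↭-trans (↭-reflexive map-letter-occurrences) (hasContent⇒↭ r {concatMap List⁺.toList us} content))))

  -- Rotation of all necklaces by one letter, transported to positions in the sorted list of
  -- occurrences.
  successor : Fin (sum r) → Fin (sum r)
  successor i = proj₁ (nth-surjective {next (nth i)} (∼-rotate₁ (nth-valid i)))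

  nth-successor : ∀ i → nth (successor i) ≡ next (nth i)
  nth-successor i = sym (proj₂ (nth-surjective {next (nth i)} (∼-rotate₁ (nth-valid i))))

  successor-injective : Injective _≡_ _≡_ successor
  successor-injective {i} {j} eq = nth-injective (next-injective
    (trans (sym (nth-successor i)) (trans (cong nth eq) (nth-successor j))))
    where
    next-injective : ∀ {s t} → next s ≡ next t → s ≡ t
    next-injective e = cong₂ _,_ (cong proj₁ e) (rotate₁-injective (cong proj₂ e))

  permutation : Permutation′ (sum r)
  permutation = permutationOf successor successor-injective

  permutation-blockMonotone : BlockMonotone r (permutation ⟨$⟩ʳ_)
  permutation-blockMonotone {i} {j} i<j eq = ℕ.≰⇒> λ j≤i → ℕ.<⇒≱
    (subst₂ (λ s t → key s < key t) (sym (nth-successor i)) (sym (nth-successor j))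
      (key-next (nth-valid i) (nth-valid j)
        (trans (nth-letter i) (trans eq (sym (nth-letter j)))) (nth-strict i<j)))
    (nth-monotone j≤i)

  nth-iterate : ∀ i k → nth (iterate successor i k) ≡ (proj₁ (nth i) , rotate k (proj₂ (nth i)))
  nth-iterate i k = trans (iterate-commute {g = next} nth nth-successor i k)
    (sym (iterate-commute {g = next} (proj₁ (nth i) ,_) (λ _ → refl) (proj₂ (nth i)) k))

  index : Fin (sum r) → Fin m
  index i = proj₁ (nth i)

  -- The lengths agree because both are the least period of `nth i` under `next`: for the cycle by
  -- injectivity of `nth`, for the rotation by primitivity.
  reading-nth : ∀ i → reading permutation c i ≡ proj₂ (nth i)
  reading-nth i = toList-injective (begin
    map c (List⁺.toList (cycleFrom permutation i))
      ≡⟨ cong (map c) (toList-cycleFrom permutation i) ⟩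
    map c (List.iterate successor i d)
      ≡⟨ map-listIterate nth nth-successor (sym ∘ nth-letter) i d ⟩
    map letter (List.iterate next (nth i) d)
      ≡⟨ map-listIterate (index i ,_) (λ _ → refl) (λ _ → refl) (proj₂ (nth i)) d ⟨
    map List⁺.head (List.iterate rotate₁ (proj₂ (nth i)) d)
      ≡⟨ cong (λ d → map List⁺.head (List.iterate rotate₁ (proj₂ (nth i)) d)) (isPeriod-unique
           (isPeriod-map {g = next} nth nth-successor nth-injective (cycleFrom-period permutation i))
           (isPeriod-map {g = next} (index i ,_) (λ _ → refl) (λ { refl → refl })
             (primitive⇒isPeriod (All.lookup prim (∈-lookup (index i))) (nth-valid i)))) ⟩
    map List⁺.head (rotations (proj₂ (nth i)))         ≡⟨ map-head-rotations (proj₂ (nth i)) ⟩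
    List⁺.toList (proj₂ (nth i))                             ∎)
    where d = List⁺.length (cycleFrom permutation i)

  -- Occurrences of the same necklace are rotations of one another, so `successor` joins them into a
  -- single cycle, and it never changes the index. Thus cycles, represented by their least elements,
  -- match necklace indices one to one.
  index-leasts : map index (leasts permutation) ↭ allFin m
  index-leasts = unique-⊆⊇⇒↭ (unique-map index index-injective (leasts-unique permutation))
    (Unique.allFin⁺ m) (λ {b} _ → ∈-allFin b) (λ {b} _ → complete b)
    where
    index-injective : ∀ {i j} → i ∈ leasts permutation → j ∈ leasts permutation → index i ≡ index j → i ≡ j
    index-injective {i} {j} i∈ j∈ eq =
      let k , e = ∼-trans {u = proj₂ (nth i)} (∼-sym {u = necklace (index i)} (nth-valid i))
                    (subst (λ b → necklace b ∼ proj₂ (nth j)) (sym eq) (nth-valid j))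
      in least-unique permutation i∈ j∈ (subst (_∈ List⁺.toList (cycleFrom permutation i))
           (nth-injective (trans (nth-iterate i k) (cong₂ _,_ eq e))) (∈-cycleFrom⁺ permutation i k))
    complete : ∀ b → b ∈ map index (leasts permutation)
    complete b =
      let i , i≡ = nth-surjective {b , necklace b} (0 , refl)
          j , j∈ , j∈i = least-in-cycle permutation i
          k , e = ∈-cycleFrom⁻ permutation j∈i
      in subst (_∈ map index (leasts permutation))
           (trans (cong index (sym e)) (trans (cong proj₁ (nth-iterate i k)) (cong proj₁ (sym i≡))))
           (∈-map⁺ index j∈)

  -- By `reading-nth` each cycle reads as a rotation of the necklace with its index, and
  -- `index-leasts` reorders these necklaces into `us`.
  readings-permutation : Permutation _∼_ (readings r permutation) us
  readings-permutation = Homogeneous.trans (Homogeneous.refl (pointwise (leasts permutation)))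
    (Homogeneous.map (λ { refl → 0 , refl }) (↭⇒↭ₛ (↭-trans
      (↭-reflexive (map-∘ (leasts permutation)))
      (↭-trans (↭.map⁺ necklace index-leasts)
        (↭-reflexive (trans (map-tabulate id necklace) (tabulate-lookup us)))))))
    where
    pointwise : ∀ is → Pointwise _∼_ (map (List⁺.map c) (map (cycleFrom permutation) is))
                                     (map (necklace ∘ index) is)
    pointwise []       = []
    pointwise (i ∷ is) = subst (_∼ necklace (index i)) (sym (reading-nth i))
      (∼-sym {u = necklace (index i)} (nth-valid i)) ∷ pointwise is

-- The map on permutations, its bijectivity and its cycle lengths.

length-map⁺ : ∀ (g : A → B) u → List⁺.length (List⁺.map g u) ≡ List⁺.length u
length-map⁺ g (x ∷ xs) = cong suc (length-map g xs)

length-filter-map : ∀ {P : Pred B 0ℓ} (P? : Decidable P) (f : A → B) xs →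
                    length (filter P? (map f xs)) ≡ length (filter (P? ∘ f) xs)
length-filter-map P? f [] = refl
length-filter-map P? f (x ∷ xs) with P? (f x)
... | yes _ = cong suc (length-filter-map P? f xs)
... | no  _ = length-filter-map P? f xs

numberOfLength-map : ∀ (g : A → B) j us → numberOfLength j (map (List⁺.map g) us) ≡ numberOfLength j us
numberOfLength-map g j us = trans
  (length-filter-map (λ u → List⁺.length u ℕ.≟ j) (List⁺.map g) us)
  (cong length (filter-≐ _ _
    ((λ {u} → trans (sym (length-map⁺ g u))) , (λ {u} → trans (length-map⁺ g u))) us))

module _ (r : Vec ℕ a) where

  private
    c = lookup (sortedWord r)

    open module M = Setoid (NecklaceMultiset (Fin a)) using () renaming (_≈_ to _≈ₘ_)

    blockMonotone : (π : PermutationWithDescentsIn (sum r) r) → BlockMonotone r (proj₁ π ⟨$⟩ʳ_)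
    blockMonotone (π , desc) = descents⇒blockMonotone r π desc

    w : PermutationWithDescentsIn (sum r) r → Vec (Fin a) (sum r)
    w π = proj₁ (word r π)

    lookup-w : ∀ π i → lookup (w π) (proj₁ π ⟨$⟩ʳ i) ≡ c i
    lookup-w π = lookup-wordOf r (proj₁ π) (blockMonotone π)

  -- `U` runs through the cycles of the inverse of `st (w π)`; since `st (w π)` is itself the
  -- inverse of the permutation, the two inversions cancel.
  U-word : ∀ π → U (w π) ≡ map (List⁺.map (lookup (w π))) (cycles (proj₁ π))
  U-word π = cong (map (List⁺.map (lookup (w π)))) (cycles-cong
    {π = flip (st (w π))} {proj₁ π}
    (inverse-inverse (st (w π)) (proj₁ π) (proj₂ (proj₁ (proj₂ (word r π))))))

  U-word≈readings : ∀ π → U (w π) ≈ₘ readings r (proj₁ π)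
  U-word≈readings π = M.trans (M.reflexive (U-word π)) (Homogeneous.refl (pointwise (leasts (proj₁ π))))
    where
    pointwise : ∀ is → Pointwise _∼_ (map (List⁺.map (lookup (w π))) (map (cycleFrom (proj₁ π)) is))
                                     (map (List⁺.map c) (map (cycleFrom (proj₁ π)) is))
    pointwise []       = []
    -- The single rotation is the shift between labelling by the word and labelling by `c`.
    pointwise (i ∷ is) = (1 , reading-∘ (proj₁ π) (lookup (w π)) (lookup-w π) i) ∷ pointwise is

  gesselReutenauer : PermutationWithDescentsIn (sum r) r → PrimitiveMultisetWithContent r
  gesselReutenauer π = U (w π) ,
    subst (All Primitive) (sym (U-word π)) (All.map⁺ (All.map⁺ (All.universal
      (reading-primitive r (proj₁ π) (blockMonotone π) (lookup-w π)) (leasts (proj₁ π))))) ,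
    -- The cycles contain every position exactly once, so the necklaces together use precisely the
    -- letters of the word.
    λ t → trans (letterCount-↭ t (↭-trans
      (↭-reflexive (trans (cong (concatMap List⁺.toList) (U-word π))
        (concatMap-toList-map (lookup (w π)) (cycles (proj₁ π)))))
      (↭-trans (↭.map⁺ (lookup (w π)) (concat-cycles (proj₁ π)))
        (↭-reflexive (sym (toList≡map-lookup r (w π)))))))
      (proj₁ (proj₁ (proj₂ (word r π))) t)

  gesselReutenauer-cong : ∀ {π σ : PermutationWithDescentsIn (sum r) r} →
                          proj₁ π ≈ proj₁ σ → U (w π) ≈ₘ U (w σ)
  gesselReutenauer-cong {π} {σ} eq = M.trans (U-word≈readings π) (M.trans
    (M.reflexive (cong (map (List⁺.map c)) (cycles-cong {π = proj₁ π} {proj₁ σ} eq)))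
    (M.sym (U-word≈readings σ)))

  gesselReutenauer-bijection : 1 ≤ a →
    Bijection (PermutationsWithDescentsIn (sum r) r) (PrimitiveMultisetsWithContent r)
  gesselReutenauer-bijection 1≤a = record
    { to        = gesselReutenauer
    ; cong      = λ {π} {σ} → gesselReutenauer-cong {π} {σ}
    ; bijective = (λ {π} {σ} → injective π σ) , surjective
    }
    where
    injective : ∀ π σ → U (w π) ≈ₘ U (w σ) → proj₁ π ≈ proj₁ σ
    injective π σ eq = valueOf-≗⇒≈ r (proj₁ π) (proj₁ σ) (blockMonotone π) (blockMonotone σ)
      (readings-↭⇒valueOf-≗ r (proj₁ π) (proj₁ σ) (blockMonotone π) (blockMonotone σ)
        (M.trans (M.sym (U-word≈readings π)) (M.trans eq (U-word≈readings σ))))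
    surjective : ∀ (us : PrimitiveMultisetWithContent r) →
                 ∃ λ (π : PermutationWithDescentsIn (sum r) r) →
                 ∀ {σ} → proj₁ σ ≈ proj₁ π → U (w σ) ≈ₘ proj₁ us
    surjective (us , prim , content) = π , λ {σ} eq → M.trans (gesselReutenauer-cong {σ} {π} eq)
      (M.trans (U-word≈readings π) readings-permutation)
      where
      open Construction r us prim content
      π : PermutationWithDescentsIn (sum r) r
      π = permutation , blockMonotone⇒descents r 1≤a permutation permutation-blockMonotone

  numberOfLength-U-word : ∀ π j → numberOfLength j (cycles (proj₁ π)) ≡ numberOfLength j (U (w π))
  numberOfLength-U-word π j = sym (trans (cong (numberOfLength j) (U-word π))
    (numberOfLength-map (lookup (w π)) j (cycles (proj₁ π))))

theorem2 : ∀ (n a : ℕ) → 1 ≤ n → 1 ≤ a → (r : Vec ℕ a) → sum r ≡ n →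
    Σ[ word ∈ ((π : PermutationWithDescentsIn n r) → ∃! _≡_ (λ (w : Vec (Fin a) n) → HasContent r (toList w) × st w ≈ flip (proj₁ π))) ]
    Σ[ Ū ∈ Bijection (PermutationsWithDescentsIn n r) (PrimitiveMultisetsWithContent r) ]
    (∀ π → Setoid._≈_ (NecklaceMultiset (Fin a)) (proj₁ (Bijection.to Ū π)) (U (proj₁ (word π))))
    × (∀ π j → 1 ≤ j → numberOfLength j (cycles (proj₁ π)) ≡ numberOfLength j (proj₁ (Bijection.to Ū π)))
theorem2 n a 1≤n 1≤a r refl =
  word r , gesselReutenauer-bijection r 1≤a ,
  (λ π → Setoid.refl (NecklaceMultiset (Fin a))) , (λ π j _ → numberOfLength-U-word r π j)
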